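{- Let $\overline{N}(m,n)$ denote the number of overpartitions of $n$ with $D$-rank $m$, and let $\overline{N2}(m,n)$ denote the number of overpartitions of $n$ with $M_2$-rank $m$ (with the convention $\overline{N}(m,-1)=\overline{N2}(m,-1)=0$). Then: (i) For all integers $m,n\geq 0$ with $n\neq m+2$ and $(m,n)\neq (0,4)$, $$\overline{N}(m,n)\geq \overline{N}(m,n-1).$$ (ii) For all integers $m,n\geq 0$, $$\overline{N2}(m,n)\geq \overline{N2}(m,n-1).$$
   Context: An overpartition of a nonnegative integer $n$ is a partition of $n$ (a weakly decreasing finite sequence of positive integers summing to $n$) in which the first occurrence of each distinct part value may (or may not) be overlined. For an overpartition $\lambda$, let $\lambda_1$ be its largest part (taken to be $0$ for the empty overpartition) and $\ell(\lambda)$ its number of parts. The $D$-rank of $\lambda$ is $\lambda_1-\ell(\lambda)$. Let $\lambda_o$ denote the partition consisting of the non-overlined odd parts of $\lambda$, and let $\chi(\lambda)=1$ if the largest part of $\lambda$ is odd and non-overlined, and $\chi(\lambda)=0$ otherwise. The $M_2$-rank of $\lambda$ is $\lfloor \lambda_1/2\rfloor-\ell(\lambda)+\ell(\lambda_o)-\chi(\lambda)$. Equivalently, with $(a;q)_k=\prod_{i=0}^{k-1}(1-aq^i)$, $$\sum_{n\ge0}\sum_{m\in\mathbb{Z}}\overline{N}(m,n)z^mq^n=\sum_{k\ge0}\frac{(-1;q)_k q^{k(k+1)/2}}{(zq;q)_k(q/z;q)_k},\qquad \sum_{n\ge0}\sum_{m\in\mathbb{Z}}\overline{N2}(m,n)z^mq^n=\sum_{k\ge0}\frac{(-1;q)_{2k}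 q^{k}}{(zq^2;q^2)_k(q^2/z;q^2)_k}.$$
   Formalization: The M₂-rank is taken with ⌈λ₁/2⌉ instead of ⌊λ₁/2⌋; this agrees with the displayed generating function, whereas with the floor part (ii) fails at (m,n)=(0,1), since both overpartitions of 1 would have rank −1. -}

module Defs where

open import Data.Nat as ℕ using (ℕ; zero; suc; _≤ᵇ_; _<ᵇ_; _≡ᵇ_; _/_)
open import Data.Nat.Base using (_%_)
open import Data.Bool using (Bool; true; false; _∧_; _∨_; not; if_then_else_)
open import Data.Product using (_×_; _,_; proj₁; proj₂)
open import Data.List using (List; []; _∷_; length; map; filter; concatMap; upTo; applyUpTo; _++_)
open import Data.Nat.ListAction using (sum)
open import Data.Integer as ℤ using (ℤ; +_; -[1+_]; _-_; _+_)
import Data.Integer.Properties as ℤP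
open import Relation.Nullary.Decidable using (⌊_⌋)

-- An overpartition is represented as the list of its parts, in order,
-- each part paired with a flag saying whether it is overlined.
Overpartition : Set
Overpartition = List (ℕ × Bool)

-- weakly decreasing, all parts positive, and an overlined part must be the
-- first occurrence of its value (i.e. strictly smaller than the previous part).
validFrom : ℕ → Overpartition → Bool
validFrom prev [] = true
validFrom prev ((p , o) ∷ rest) =
  (1 ≤ᵇ p) ∧ (p ≤ᵇ prev) ∧ (not o ∨ (p <ᵇ prev)) ∧ validFrom p rest

isOverpartitionOf : ℕ → Overpartition → Bool
isOverpartitionOf n [] = n ≡ᵇ 0
isOverpartitionOf n ((p , o) ∷ rest) =
  (sum (map proj₁ ((p , o) ∷ rest)) ≡ᵇ n) ∧ (1 ≤ᵇ p) ∧ validFrom p rest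

listsOfLength : {A : Set} → ℕ → List A → List (List A)
listsOfLength zero xs = [] ∷ []
listsOfLength (suc k) xs = concatMap (λ x → map (x ∷_) (listsOfLength k xs)) xs

candidates : ℕ → List Overpartition
candidates n = concatMap (λ k → listsOfLength k parts) (upTo (suc n))
  where
  parts : List (ℕ × Bool)
  parts = concatMap (λ i → (suc i , false) ∷ (suc i , true) ∷ []) (upTo n)

overpartitions : ℕ → List Overpartition
overpartitions n = filter (λ l → isOverpartitionOf n l Data.Bool.≟ true) (candidates n)
  where import Data.Bool

largestPart : Overpartition → ℕ
largestPart [] = 0
largestPart ((p , _) ∷ _) = p

numParts : Overpartition → ℕ
numParts = length

isOdd : ℕ → Bool
isOdd p = (p % 2) ≡ᵇ 1

dRank : Overpartition → ℤ
dRank λ′ = + largestPart λ′ - + numParts λ′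

numNonOverlinedOdd : Overpartition → ℕ
numNonOverlinedOdd λ′ = length (filter (λ po → (isOdd (proj₁ po) ∧ not (proj₂ po)) Data.Bool.≟ true) λ′)
  where import Data.Bool

chi : Overpartition → ℕ
chi [] = 0
chi ((p , o) ∷ _) = if isOdd p ∧ not o then 1 else 0

-- M₂-rank: ⌈λ₁/2⌉ − ℓ(λ) + ℓ(λ_o) − χ(λ)   (⌈x/2⌉ = (x+1)/2 on ℕ)
m2Rank : Overpartition → ℤ
m2Rank λ′ = + (suc (largestPart λ′) / 2) - + numParts λ′ + + numNonOverlinedOdd λ′ - + chi λ′

countWith : (Overpartition → ℤ) → ℤ → ℕ → ℕ
countWith r m n = length (filter (λ l → r l ℤ.≟ m) (overpartitions n))

-- N̄(m,n) and N̄2(m,n), with n ranging over ℤ; for negative n there are no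
-- overpartitions, so the value is 0 (this gives the convention N̄(m,−1)=0).
Nbar : ℤ → ℤ → ℕ
Nbar m (+ n) = countWith dRank m n
Nbar m -[1+ _ ] = 0

N2bar : ℤ → ℤ → ℕ
N2bar m (+ n) = countWith m2Rank m n
N2bar m -[1+ _ ] = 0

{-# OPTIONS --safe #-}

-- (ii) Appending a non-overlined part 1 preserves the M₂-rank.
--
-- (i) Let V_p be the generating function of the overpartitions that may follow
-- a first part p, with t marking the number of parts.  For n ≥ 1, N̄(m,n) is
-- twice the coefficient of qⁿ in F_m = Σ_p q^p [t^{p-1-m}] V_p, where m ranges
-- over all integers.  For p ≥ 2, V_p = V_{p-1} (1 + t q^{p-1}) / (1 - t q^p).
-- Put Y_p = V_{p-1} / (1 - t q^p) and K_m = Σ_p q^{2p-1} [t^{p-2-m}] Y_p (over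
-- p ≥ 2); comparing V_p with V_{p-1} gives
--     F_m = q F_{m-1} + (1 + q) K_m + T_m,    T_m = q^{1-m} if m ≤ 0, else 0.
-- Adding a part 1 gives K_{m-1} ≥ q K_m, so without the terms T_m induction on
-- the exponent yields (1 - q) F_m ≥ K_m ≥ 0.  The terms T_m contribute
-- H_m = q^{|m|+1} / (1 - q²) to F_m, so for m ≥ 0 they subtract 1 from the
-- coefficients of (1 - q) F_m at n = m+2, m+4, ….  From n = m+4 on (n = 6 if
-- m = 0) this is repaid by surpluses J in K_{m'} ≥ q K_{m'+1} + J_{m'}, m' ≤ 1,
-- which the recurrence carries up to m: J_1 = q⁵ and, from adding parts 1 and 3,
-- J_{-s} = q⁵ (q^{3s+1} + q^{3s+3}).

module Submission where

open import Defs
open import Data.Bool using (Bool; true; false; _∧_; _∨_; not; if_then_else_)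
import Data.Bool as Bool
open import Data.Integer using (ℤ) renaming (+_ to pos; -[1+_] to negsuc)
import Data.Integer as ℤ
import Data.Integer.Properties as ℤP
import Data.Integer.Tactic.RingSolver as ℤ-Solver
open import Data.List using (List; []; _∷_; _∷ʳ_; _++_; length; map; filter; concatMap; upTo)
open import Data.List.Membership.Propositional using (_∈_; lose; find)
open import Data.List.Membership.Propositional.Properties
open import Data.List.Properties using (upTo-∷ʳ; length-++; length-map; filter-++; map-++; ∷ʳ-injectiveˡ; ∷-injective)
open import Data.List.Relation.Unary.All as All using (All; []; _∷_)
open import Data.List.Relation.Unary.AllPairs using ([]; _∷_)
open import Data.List.Relation.Unary.Any using (here; there)
open import Data.List.Relation.Unary.Unique.Propositional using (Unique)
import Data.List.Relation.Unary.Unique.Propositional.Properties as Unique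
open import Data.Nat using (ℕ; zero; suc; _+_; _*_; _≤_; _<_; z≤n; s≤s; _≡ᵇ_; _<ᵇ_; _≤?_; _<?_)
import Data.Nat as ℕ
open import Data.Nat.ListAction using (sum)
open import Data.Nat.ListAction.Properties using (sum-++)
open import Data.Nat.Properties
open import Data.Nat.Tactic.RingSolver using (solve-∀)
open import Data.Product using (_×_; _,_; proj₁; proj₂)
open import Data.Sum using (inj₁; inj₂)
open import Function using (_∘_; mk⇔)
open import Relation.Binary.PropositionalEquality
open import Relation.Nullary using (¬_; yes; no; does; contradiction)
open import Relation.Nullary.Decidable using (does-⇔)
open import Relation.Unary using (Pred; Decidable)

-- Power series in q

Series : Set
Series = ℕ → ℕ

infix 4 _≼_
infixl 6 _⊕_
infixr 7 _▷_

_≼_ : Series → Series → Set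
f ≼ g = ∀ n → f n ≤ g n

_⊕_ : Series → Series → Series
(f ⊕ g) n = f n + g n

-- c ▷ f = q^c f
_▷_ : ℕ → Series → Series
(zero ▷ f) n = f n
(suc k ▷ f) zero = 0
(suc k ▷ f) (suc n) = (k ▷ f) n

𝟘 : Series
𝟘 _ = 0

δ : Series
δ zero = 1
δ (suc _) = 0

▷-cong : ∀ c {f g} → f ≗ g → c ▷ f ≗ c ▷ g
▷-cong zero e n = e n
▷-cong (suc c) e zero = refl
▷-cong (suc c) e (suc n) = ▷-cong c e n

▷-mono : ∀ c {f g} → f ≼ g → c ▷ f ≼ c ▷ g
▷-mono zero e n = e n
▷-mono (suc c) e zero = z≤n
▷-mono (suc c) e (suc n) = ▷-mono c e n

▷-⊕ : ∀ c f g → c ▷ (f ⊕ g) ≗ c ▷ f ⊕ c ▷ g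
▷-⊕ zero f g n = refl
▷-⊕ (suc c) f g zero = refl
▷-⊕ (suc c) f g (suc n) = ▷-⊕ c f g n

▷-▷ : ∀ c d f → c ▷ d ▷ f ≗ (c + d) ▷ f
▷-▷ zero d f n = refl
▷-▷ (suc c) d f zero = refl
▷-▷ (suc c) d f (suc n) = ▷-▷ c d f n

▷-exchange : ∀ c d f → c ▷ d ▷ f ≗ d ▷ c ▷ f
▷-exchange c d f n = begin
  (c ▷ d ▷ f) n   ≡⟨ ▷-▷ c d f n ⟩
  ((c + d) ▷ f) n ≡⟨ cong (λ e → (e ▷ f) n) (+-comm c d) ⟩
  ((d + c) ▷ f) n ≡⟨ ▷-▷ d c f n ⟨
  (d ▷ c ▷ f) n   ∎
  where open ≡-Reasoning

▷-below : ∀ c f {n} → n < c → (c ▷ f) n ≡ 0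
▷-below (suc c) f {zero} _ = refl
▷-below (suc c) f {suc n} (s≤s n<c) = ▷-below c f n<c

▷-δ : ∀ c → (c ▷ δ) c ≡ 1
▷-δ zero = refl
▷-δ (suc c) = ▷-δ c

Σ< : ℕ → (ℕ → ℕ) → ℕ
Σ< zero f = 0
Σ< (suc n) f = Σ< n f + f n

Σ<-cong : ∀ n {f g : ℕ → ℕ} → (∀ i → i < n → f i ≡ g i) → Σ< n f ≡ Σ< n g
Σ<-cong zero e = refl
Σ<-cong (suc n) e = cong₂ _+_ (Σ<-cong n (λ i i<n → e i (m<n⇒m<1+n i<n))) (e n ≤-refl)

Σ<-mono : ∀ n {f g : ℕ → ℕ} → (∀ i → f i ≤ g i) → Σ< n f ≤ Σ< n g
Σ<-mono zero e = z≤n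
Σ<-mono (suc n) e = +-mono-≤ (Σ<-mono n e) (e n)

Σ<-shift : ∀ n (f : ℕ → ℕ) → Σ< (suc n) f ≡ f 0 + Σ< n (λ k → f (suc k))
Σ<-shift zero f = sym (+-identityʳ _)
Σ<-shift (suc n) f = trans (cong (_+ f (suc n)) (Σ<-shift n f)) (+-assoc (f 0) _ _)

Σ<-▷ : ∀ c n (g : ℕ → Series) s → Σ< n (λ i → (c ▷ g i) s) ≡ (c ▷ (λ s → Σ< n (λ i → g i s))) s
Σ<-▷ c zero g s = sym (▷-𝟘 c s)
  where
  ▷-𝟘 : ∀ c → c ▷ 𝟘 ≗ 𝟘
  ▷-𝟘 zero n = refl
  ▷-𝟘 (suc c) zero = refl
  ▷-𝟘 (suc c) (suc n) = ▷-𝟘 c n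
Σ<-▷ c (suc n) g s = trans (cong (_+ (c ▷ g n) s) (Σ<-▷ c n g s)) (sym (▷-⊕ c _ (g n) s))

-- S g = Σⱼ qʲ gⱼ
S : (ℕ → Series) → Series
S g zero = g 0 zero
S g (suc n) = g 0 (suc n) + S (λ j → g (suc j)) n

S-split : ∀ g → S g ≗ g 0 ⊕ 1 ▷ S (λ j → g (suc j))
S-split g zero = sym (+-identityʳ _)
S-split g (suc n) = refl

S-cong : ∀ {g h} → (∀ j → g j ≗ h j) → S g ≗ S h
S-cong e zero = e 0 0
S-cong e (suc n) = cong₂ _+_ (e 0 (suc n)) (S-cong (λ j → e (suc j)) n)

S-mono : ∀ {g h} → (∀ j → g j ≼ h j) → S g ≼ S h
S-mono e zero = e 0 0
S-mono e (suc n) = +-mono-≤ (e 0 (suc n)) (S-mono (λ j → e (suc j)) n)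

interchange : ∀ a b c d → (a + b) + (c + d) ≡ (a + c) + (b + d)
interchange = solve-∀

S-⊕ : ∀ g h → S (λ j → g j ⊕ h j) ≗ S g ⊕ S h
S-⊕ g h zero = refl
S-⊕ g h (suc n) = trans
  (cong ((g 0 (suc n) + h 0 (suc n)) +_) (S-⊕ (λ j → g (suc j)) (λ j → h (suc j)) n))
  (interchange (g 0 (suc n)) (h 0 (suc n)) _ _)

S-▷₁ : ∀ g → S (λ j → 1 ▷ g j) ≗ 1 ▷ S g
S-▷₁ g zero = refl
S-▷₁ g (suc n) = trans (cong (g 0 n +_) (S-▷₁ (λ j → g (suc j)) n)) (sym (S-split g n))

S-▷ : ∀ c g → S (λ j → c ▷ g j) ≗ c ▷ S g
S-▷ zero g n = refl
S-▷ (suc c) g n = begin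
  S (λ j → suc c ▷ g j) n    ≡⟨ S-cong (λ j → ▷-▷ 1 c (g j)) n ⟨
  S (λ j → 1 ▷ c ▷ g j) n    ≡⟨ S-▷₁ (λ j → c ▷ g j) n ⟩
  (1 ▷ S (λ j → c ▷ g j)) n  ≡⟨ ▷-cong 1 (S-▷ c g) n ⟩
  (1 ▷ c ▷ S g) n            ≡⟨ ▷-▷ 1 c (S g) n ⟩
  (suc c ▷ S g) n            ∎
  where open ≡-Reasoning

▷-S-▷ : ∀ c d (h : ℕ → Series) → c ▷ S (λ j → (d + j) ▷ h j) ≗ (c + d) ▷ S (λ j → j ▷ h j)
▷-S-▷ c d h n = begin
  (c ▷ S (λ j → (d + j) ▷ h j)) n  ≡⟨ ▷-cong c (S-cong (λ j → ▷-▷ d j (h j))) n ⟨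
  (c ▷ S (λ j → d ▷ j ▷ h j)) n    ≡⟨ ▷-cong c (S-▷ d (λ j → j ▷ h j)) n ⟩
  (c ▷ d ▷ S (λ j → j ▷ h j)) n    ≡⟨ ▷-▷ c d _ n ⟩
  ((c + d) ▷ S (λ j → j ▷ h j)) n  ∎
  where open ≡-Reasoning

-- The rank recurrence

-- v p k = [t^k] V_{p+1} and y p k = [t^k] Y_{p+2}: both indices are shifted so
-- that every p : ℕ is admissible.
v : ℕ → ℕ → Series
v p zero = δ
v p (suc k) s = Σ< (suc p) (λ i → (suc i ▷ v i k) s) + Σ< p (λ i → (suc i ▷ v i k) s)

y : ℕ → ℕ → Series
y p zero = δ
y p (suc k) = v p (suc k) ⊕ (2 + p) ▷ y p k

-- Raising the bound from p+1 to p+2 admits exactly two new choices for the next part: p+2 without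
-- an overline and p+1 with one. In series, (1 - t q^(p+2)) V_{p+2} = (1 + t q^(p+1)) V_{p+1}.
v-recurrence : ∀ p k → v (suc p) (suc k) ≗ v p (suc k) ⊕ (2 + p) ▷ v (suc p) k ⊕ suc p ▷ v p k
v-recurrence p k n = lemma (Σ< p _) ((suc p ▷ v p k) n) (((2 + p) ▷ v (suc p) k) n)
  where
  lemma : ∀ a b c → (a + b + c) + (a + b) ≡ ((a + b) + a) + c + b
  lemma = solve-∀

-- V_{p+1} = (1 - t q^(p+2)) Y_{p+2} and V_{p+2} = (1 + t q^(p+1)) Y_{p+2}, so they differ by t
-- (q^(p+1) + q^(p+2)) Y_{p+2}. Induction on k takes the place of the division.
v-y : ∀ p k → v (suc p) (suc k) ≗ v p (suc k) ⊕ (suc p ▷ y p k ⊕ (2 + p) ▷ y p k)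
v-y p zero n = trans (v-recurrence p 0 n) (lemma (v p 1 n) (((2 + p) ▷ δ) n) ((suc p ▷ δ) n))
  where
  lemma : ∀ a b c → a + b + c ≡ a + (c + b)
  lemma = solve-∀
v-y p (suc k) n = begin
  v (suc p) (suc (suc k)) n
    ≡⟨ v-recurrence p (suc k) n ⟩
  V + ((2 + p) ▷ v (suc p) (suc k)) n + (suc p ▷ v p (suc k)) n
    ≡⟨ cong (λ x → V + x + (suc p ▷ v p (suc k)) n) e₁ ⟩
  V + (A + (B + C)) + (suc p ▷ v p (suc k)) n
    ≡⟨ lemma V A B C _ ⟩
  V + (((suc p ▷ v p (suc k)) n + B) + (A + C))
    ≡⟨ cong (V +_) (cong₂ _+_ e₂ (sym (▷-⊕ (2 + p) _ _ n))) ⟩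
  V + ((suc p ▷ y p (suc k)) n + ((2 + p) ▷ y p (suc k)) n) ∎
  where
  open ≡-Reasoning
  V = v p (suc (suc k)) n
  A = ((2 + p) ▷ v p (suc k)) n
  B = ((2 + p) ▷ suc p ▷ y p k) n
  C = ((2 + p) ▷ (2 + p) ▷ y p k) n
  e₁ : ((2 + p) ▷ v (suc p) (suc k)) n ≡ A + (B + C)
  e₁ = begin
    ((2 + p) ▷ v (suc p) (suc k)) n ≡⟨ ▷-cong (2 + p) (v-y p k) n ⟩
    ((2 + p) ▷ (v p (suc k) ⊕ (suc p ▷ y p k ⊕ (2 + p) ▷ y p k))) n ≡⟨ ▷-⊕ (2 + p) _ _ n ⟩
    A + ((2 + p) ▷ (suc p ▷ y p k ⊕ (2 + p) ▷ y p k)) n ≡⟨ cong (A +_) (▷-⊕ (2 + p) _ _ n) ⟩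
    A + (B + C) ∎
  e₂ : (suc p ▷ v p (suc k)) n + B ≡ (suc p ▷ y p (suc k)) n
  e₂ = trans (cong ((suc p ▷ v p (suc k)) n +_) (▷-exchange (2 + p) (suc p) (y p k) n)) (sym (▷-⊕ (suc p) _ _ n))
  lemma : ∀ v a b c w → v + (a + (b + c)) + w ≡ v + ((w + b) + (a + c))
  lemma = solve-∀

-- Appending a part 1 to the tail of an overpartition

first-term : ∀ p (f : ℕ → ℕ) → f 0 ≤ Σ< (suc p) f
first-term zero f = ≤-refl
first-term (suc p) f = ≤-trans (first-term p f) (m≤m+n _ _)

-- A non-overlined 1 may be appended after any part; the induction carries it past the leading part
-- of the tail.
v-add-one : ∀ p k → 1 ▷ v p k ≼ v p (suc k)
v-add-one p zero n = ≤-trans (first-term p (λ i → (suc i ▷ δ) n)) (m≤m+n _ _)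
v-add-one p (suc k) n = begin
  (1 ▷ v p (suc k)) n
    ≡⟨ ▷-⊕ 1 _ _ n ⟩
  (1 ▷ (λ s → Σ< (suc p) (λ i → (suc i ▷ v i k) s))) n + (1 ▷ (λ s → Σ< p (λ i → (suc i ▷ v i k) s))) n
    ≡⟨ cong₂ _+_ (Σ<-▷ 1 (suc p) _ n) (Σ<-▷ 1 p _ n) ⟨
  Σ< (suc p) (λ i → (1 ▷ suc i ▷ v i k) n) + Σ< p (λ i → (1 ▷ suc i ▷ v i k) n)
    ≤⟨ +-mono-≤ (Σ<-mono (suc p) step) (Σ<-mono p step) ⟩
  v p (suc (suc k)) n ∎
  where
  open ≤-Reasoning
  step : ∀ i → (1 ▷ suc i ▷ v i k) n ≤ (suc i ▷ v i (suc k)) n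
  step i = ≤-trans (≤-reflexive (▷-exchange 1 (suc i) (v i k) n)) (▷-mono (suc i) (v-add-one i k) n)

y-add-one : ∀ p k → 1 ▷ y p k ≼ y p (suc k)
y-add-one p zero n = ≤-trans (v-add-one p 0 n) (m≤m+n _ _)
y-add-one p (suc k) n = begin
  (1 ▷ y p (suc k)) n
    ≡⟨ ▷-⊕ 1 _ _ n ⟩
  (1 ▷ v p (suc k)) n + (1 ▷ (2 + p) ▷ y p k) n
    ≡⟨ cong ((1 ▷ v p (suc k)) n +_) (▷-exchange 1 (2 + p) (y p k) n) ⟩
  (1 ▷ v p (suc k)) n + ((2 + p) ▷ 1 ▷ y p k) n
    ≤⟨ +-mono-≤ (v-add-one p (suc k) n) (▷-mono (2 + p) (y-add-one p k) n) ⟩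
  y p (suc (suc k)) n ∎
  where open ≤-Reasoning

-- `y 1` belongs to Y_3 = V_2 / (1 - t q^3). Appending a non-overlined 1 never produces s parts 3
-- followed by an overlined 1, nor s+1 parts 3; these account for q^(3s+1) and q^(3s+3). Each
-- induction step puts one more 3 in front.
y₁-bonus : ∀ s → 1 ▷ y 1 s ⊕ ((1 + s * 3) ▷ δ ⊕ (3 + s * 3) ▷ δ) ≼ y 1 (suc s)
y₁-bonus zero n = ≤-trans (m≤m+n _ ((2 ▷ δ) n)) (≤-reflexive (lemma ((1 ▷ δ) n) ((2 ▷ δ) n) ((3 ▷ δ) n)))
  where
  lemma : ∀ a b c → a + (a + c) + b ≡ (a + b) + a + c
  lemma = solve-∀
y₁-bonus (suc s) n = begin
  (1 ▷ y 1 (suc s)) n + (((4 + s * 3) ▷ δ) n + ((6 + s * 3) ▷ δ) n)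
    ≡⟨ cong₂ _+_ (▷-⊕ 1 _ _ n) (cong₂ _+_ (sym (▷-▷ 3 (1 + s * 3) δ n)) (sym (▷-▷ 3 (3 + s * 3) δ n))) ⟩
  ((1 ▷ v 1 (suc s)) n + (1 ▷ 3 ▷ y 1 s) n) + ((3 ▷ (1 + s * 3) ▷ δ) n + (3 ▷ (3 + s * 3) ▷ δ) n)
    ≡⟨ cong₂ (λ a b → ((1 ▷ v 1 (suc s)) n + a) + b) (▷-exchange 1 3 (y 1 s) n) (sym (▷-⊕ 3 _ _ n)) ⟩
  ((1 ▷ v 1 (suc s)) n + (3 ▷ 1 ▷ y 1 s) n) + (3 ▷ ((1 + s * 3) ▷ δ ⊕ (3 + s * 3) ▷ δ)) n
    ≡⟨ +-assoc ((1 ▷ v 1 (suc s)) n) _ _ ⟩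
  (1 ▷ v 1 (suc s)) n + ((3 ▷ 1 ▷ y 1 s) n + (3 ▷ ((1 + s * 3) ▷ δ ⊕ (3 + s * 3) ▷ δ)) n)
    ≡⟨ cong ((1 ▷ v 1 (suc s)) n +_) (▷-⊕ 3 _ _ n) ⟨
  (1 ▷ v 1 (suc s)) n + (3 ▷ (1 ▷ y 1 s ⊕ ((1 + s * 3) ▷ δ ⊕ (3 + s * 3) ▷ δ))) n
    ≤⟨ +-mono-≤ (v-add-one 1 (suc s) n) (▷-mono 3 (y₁-bonus s) n) ⟩
  y 1 (suc (suc s)) n ∎
  where open ≤-Reasoning

-- Recurrences for F_m in the rank m

v₀ : ∀ b → v 0 b ≗ b ▷ δ
v₀ zero n = refl
v₀ (suc b) n = begin
  (1 ▷ v 0 b) n + 0  ≡⟨ +-identityʳ _ ⟩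
  (1 ▷ v 0 b) n      ≡⟨ ▷-cong 1 (v₀ b) n ⟩
  (1 ▷ b ▷ δ) n      ≡⟨ ▷-▷ 1 b δ n ⟩
  (suc b ▷ δ) n      ∎
  where open ≡-Reasoning

-- The sum K_m with the factor q^(3+2a) taken out, indexed by p = a+j+2. `S` and `j ▷` supply one
-- factor q^j each, hence the q^(2j) in q^(2p-1).
Q : ℕ → ℕ → Series
Q a b = S (λ j → j ▷ y (a + j) (b + j))

S-v-y : ∀ a b → S (λ j → v (suc (a + j)) (suc (b + j)))
  ≗ S (λ j → v (a + j) (suc (b + j))) ⊕ (suc a ▷ Q a b ⊕ (2 + a) ▷ Q a b)
S-v-y a b n = begin
  S (λ j → v (suc (a + j)) (suc (b + j))) n
    ≡⟨ S-cong (λ j → v-y (a + j) (b + j)) n ⟩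
  S (λ j → v (a + j) (suc (b + j)) ⊕ (suc (a + j) ▷ y (a + j) (b + j) ⊕ (2 + (a + j)) ▷ y (a + j) (b + j))) n
    ≡⟨ S-⊕ _ _ n ⟩
  X + S (λ j → suc (a + j) ▷ y (a + j) (b + j) ⊕ (2 + (a + j)) ▷ y (a + j) (b + j)) n
    ≡⟨ cong (X +_) (S-⊕ _ _ n) ⟩
  X + (S (λ j → (suc a + j) ▷ y (a + j) (b + j)) n + S (λ j → (2 + a + j) ▷ y (a + j) (b + j)) n)
    ≡⟨ cong (X +_) (cong₂ _+_ (▷-S-▷ 0 (suc a) _ n) (▷-S-▷ 0 (2 + a) _ n)) ⟩
  X + ((suc a ▷ Q a b) n + ((2 + a) ▷ Q a b) n) ∎
  where
  open ≡-Reasoning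
  X = S (λ j → v (a + j) (suc (b + j))) n

-- F a b and K a b stand for F_m and K_m with m = a - b, and are only used when
-- a = 0 or b = 0.
F K : ℕ → ℕ → Series
F a b = suc a ▷ S (λ j → v (a + j) (b + j))
K a b = (3 + (a + a)) ▷ Q a b

▷-K : ∀ a b c → c ≡ 2 + a → c ▷ (suc a ▷ Q a b ⊕ (2 + a) ▷ Q a b) ≗ K a b ⊕ 1 ▷ K a b
▷-K a b _ refl n = begin
  ((2 + a) ▷ (suc a ▷ Q a b ⊕ (2 + a) ▷ Q a b)) n
    ≡⟨ ▷-⊕ (2 + a) _ _ n ⟩
  ((2 + a) ▷ suc a ▷ Q a b) n + ((2 + a) ▷ (2 + a) ▷ Q a b) n
    ≡⟨ cong₂ _+_ (▷-▷ (2 + a) (suc a) (Q a b) n) (▷-▷ (2 + a) (2 + a) (Q a b) n) ⟩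
  ((2 + a + suc a) ▷ Q a b) n + ((2 + a + (2 + a)) ▷ Q a b) n
    ≡⟨ cong₂ (λ c d → (c ▷ Q a b) n + (d ▷ Q a b) n) (e₁ a) (e₂ a) ⟩
  K a b n + ((1 + (3 + (a + a))) ▷ Q a b) n
    ≡⟨ cong (K a b n +_) (▷-▷ 1 (3 + (a + a)) (Q a b) n) ⟨
  K a b n + (1 ▷ K a b) n ∎
  where
  open ≡-Reasoning
  e₁ : ∀ a → 2 + a + suc a ≡ 3 + (a + a)
  e₁ = solve-∀
  e₂ : ∀ a → 2 + a + (2 + a) ≡ 4 + (a + a)
  e₂ = solve-∀

-- The case m ≥ 1. The term j = 0 has t-degree 0, where V_p and V_{p-1} both have coefficient 1, so
-- it goes over unchanged; `S-v-y` treats the terms j ≥ 1.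
F-suc : ∀ a → F (suc a) 0 ≗ 1 ▷ F a 0 ⊕ (K (suc a) 0 ⊕ 1 ▷ K (suc a) 0)
F-suc a n = begin
  ((2 + a) ▷ S (λ j → v (suc a + j) j)) n
    ≡⟨ ▷-cong (2 + a) inner n ⟩
  ((2 + a) ▷ (S (λ j → v (a + j) j) ⊕ 1 ▷ R)) n
    ≡⟨ ▷-⊕ (2 + a) _ _ n ⟩
  ((2 + a) ▷ S (λ j → v (a + j) j)) n + ((2 + a) ▷ 1 ▷ R) n
    ≡⟨ cong₂ _+_ (▷-▷ 1 (suc a) _ n) (sym (▷-▷ (2 + a) 1 R n)) ⟨
  (1 ▷ F a 0) n + ((2 + a + 1) ▷ R) n
    ≡⟨ cong ((1 ▷ F a 0) n +_) (▷-K (suc a) 0 (2 + a + 1) (+-comm (2 + a) 1) n) ⟩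
  (1 ▷ F a 0) n + (K (suc a) 0 n + (1 ▷ K (suc a) 0) n) ∎
  where
  open ≡-Reasoning
  R = suc (suc a) ▷ Q (suc a) 0 ⊕ (3 + a) ▷ Q (suc a) 0
  tail : S (λ j → v (suc a + suc j) (suc j)) ≗ S (λ j → v (a + suc j) (suc j)) ⊕ R
  tail m = begin
    S (λ j → v (suc a + suc j) (suc j)) m
      ≡⟨ S-cong (λ j i → cong (λ x → v (suc x) (suc j) i) (+-suc a j)) m ⟩
    S (λ j → v (suc (suc a + j)) (suc j)) m
      ≡⟨ S-v-y (suc a) 0 m ⟩
    S (λ j → v (suc a + j) (suc j)) m + R m
      ≡⟨ cong (_+ R m) (S-cong (λ j i → cong (λ x → v x (suc j) i) (+-suc a j)) m) ⟨
    S (λ j → v (a + suc j) (suc j)) m + R m ∎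
  inner : S (λ j → v (suc a + j) j) ≗ S (λ j → v (a + j) j) ⊕ 1 ▷ R
  inner m = begin
    S (λ j → v (suc a + j) j) m
      ≡⟨ S-split _ m ⟩
    δ m + (1 ▷ S (λ j → v (suc a + suc j) (suc j))) m
      ≡⟨ cong (δ m +_) (trans (▷-cong 1 tail m) (▷-⊕ 1 _ _ m)) ⟩
    δ m + ((1 ▷ S (λ j → v (a + suc j) (suc j))) m + (1 ▷ R) m)
      ≡⟨ +-assoc (δ m) _ _ ⟨
    δ m + (1 ▷ S (λ j → v (a + suc j) (suc j))) m + (1 ▷ R) m
      ≡⟨ cong (_+ (1 ▷ R) m) (S-split _ m) ⟨
    S (λ j → v (a + j) j) m + (1 ▷ R) m ∎

-- The case m = -b ≤ 0. The term p = 1 has no V_0 to be compared with: a first part 1 is followed by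
-- b further parts 1, giving q^(b+1), which is T_m.
F-zero : ∀ b → F 0 b ≗ 1 ▷ F 0 (suc b) ⊕ (K 0 b ⊕ 1 ▷ K 0 b) ⊕ suc b ▷ δ
F-zero b n = begin
  (1 ▷ S (λ j → v j (b + j))) n
    ≡⟨ ▷-cong 1 (S-split _) n ⟩
  (1 ▷ (v 0 (b + 0) ⊕ 1 ▷ S (λ j → v (suc j) (b + suc j)))) n
    ≡⟨ ▷-⊕ 1 _ _ n ⟩
  (1 ▷ v 0 (b + 0)) n + (1 ▷ 1 ▷ S (λ j → v (suc j) (b + suc j))) n
    ≡⟨ cong₂ _+_ e₁ (▷-▷ 1 1 _ n) ⟩
  (suc b ▷ δ) n + (2 ▷ S (λ j → v (suc j) (b + suc j))) n
    ≡⟨ cong ((suc b ▷ δ) n +_) (▷-cong 2 e₂ n) ⟩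
  (suc b ▷ δ) n + (2 ▷ (S (λ j → v j (suc b + j)) ⊕ R)) n
    ≡⟨ cong ((suc b ▷ δ) n +_) (▷-⊕ 2 _ _ n) ⟩
  (suc b ▷ δ) n + ((2 ▷ S (λ j → v j (suc b + j))) n + (2 ▷ R) n)
    ≡⟨ cong₂ (λ x z → (suc b ▷ δ) n + (x + z)) (sym (▷-▷ 1 1 _ n)) (▷-K 0 b 2 refl n) ⟩
  (suc b ▷ δ) n + ((1 ▷ F 0 (suc b)) n + (K 0 b n + (1 ▷ K 0 b) n))
    ≡⟨ +-comm ((suc b ▷ δ) n) _ ⟩
  (1 ▷ F 0 (suc b)) n + (K 0 b n + (1 ▷ K 0 b) n) + (suc b ▷ δ) n ∎
  where
  open ≡-Reasoning
  R = 1 ▷ Q 0 b ⊕ 2 ▷ Q 0 b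
  e₁ : (1 ▷ v 0 (b + 0)) n ≡ (suc b ▷ δ) n
  e₁ = begin
    (1 ▷ v 0 (b + 0)) n ≡⟨ cong (λ c → (1 ▷ v 0 c) n) (+-identityʳ b) ⟩
    (1 ▷ v 0 b) n       ≡⟨ ▷-cong 1 (v₀ b) n ⟩
    (1 ▷ b ▷ δ) n       ≡⟨ ▷-▷ 1 b δ n ⟩
    (suc b ▷ δ) n       ∎
  e₂ : S (λ j → v (suc j) (b + suc j)) ≗ S (λ j → v j (suc b + j)) ⊕ R
  e₂ m = trans (S-cong (λ j i → cong (λ x → v (suc j) x i) (+-suc b j)) m) (S-v-y 0 b m)

-- Comparing K_(m-1) with q K_m

Q-unfold : ∀ a b → Q a b ≗ y a b ⊕ 2 ▷ Q (suc a) (suc b)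
Q-unfold a b n = begin
  Q a b n
    ≡⟨ S-split _ n ⟩
  y (a + 0) (b + 0) n + (1 ▷ S (λ j → suc j ▷ y (a + suc j) (b + suc j))) n
    ≡⟨ cong₂ _+_ (cong₂ (λ c d → y c d n) (+-identityʳ a) (+-identityʳ b)) (▷-cong 1 (S-cong shift-index) n) ⟩
  y a b n + (1 ▷ S (λ j → (1 + j) ▷ y (suc a + j) (suc b + j))) n
    ≡⟨ cong (y a b n +_) (▷-S-▷ 1 1 _ n) ⟩
  y a b n + (2 ▷ Q (suc a) (suc b)) n ∎
  where
  open ≡-Reasoning
  shift-index : ∀ j → suc j ▷ y (a + suc j) (b + suc j) ≗ (1 + j) ▷ y (suc a + j) (suc b + j)
  shift-index j i = cong₂ (λ c d → (suc j ▷ y c d) i) (+-suc a j) (+-suc b j)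

Q-add-one : ∀ a b → 1 ▷ Q a b ≼ Q a (suc b)
Q-add-one a b n = begin
  (1 ▷ Q a b) n
    ≡⟨ S-▷ 1 _ n ⟨
  S (λ j → 1 ▷ j ▷ y (a + j) (b + j)) n
    ≤⟨ S-mono (λ j i → ≤-trans (≤-reflexive (▷-exchange 1 j _ i)) (▷-mono j (y-add-one (a + j) (b + j)) i)) n ⟩
  Q a (suc b) n ∎
  where open ≤-Reasoning

E : ℕ → Series
E s = (1 + s * 3) ▷ δ ⊕ (3 + s * 3) ▷ δ

-- The whole surplus sits in the term j = 0, which is `y 1`; the later terms are compared by
-- `Q-add-one`.
Q₁-bonus : ∀ s → 1 ▷ Q 1 s ⊕ E s ≼ Q 1 (suc s)
Q₁-bonus s n = begin
  (1 ▷ Q 1 s) n + E s n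
    ≡⟨ cong (_+ E s n) (trans (▷-cong 1 (Q-unfold 1 s) n) (▷-⊕ 1 _ _ n)) ⟩
  (1 ▷ y 1 s) n + (1 ▷ 2 ▷ Q 2 (suc s)) n + E s n
    ≡⟨ lemma ((1 ▷ y 1 s) n) _ (E s n) ⟩
  (1 ▷ y 1 s) n + E s n + (1 ▷ 2 ▷ Q 2 (suc s)) n
    ≡⟨ cong ((1 ▷ y 1 s) n + E s n +_) (▷-exchange 1 2 (Q 2 (suc s)) n) ⟩
  (1 ▷ y 1 s) n + E s n + (2 ▷ 1 ▷ Q 2 (suc s)) n
    ≤⟨ +-mono-≤ (y₁-bonus s n) (▷-mono 2 (Q-add-one 2 (suc s)) n) ⟩
  y 1 (suc s) n + (2 ▷ Q 2 (suc (suc s))) n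
    ≡⟨ Q-unfold 1 (suc s) n ⟨
  Q 1 (suc s) n ∎
  where
  open ≤-Reasoning
  lemma : ∀ a b c → a + b + c ≡ a + c + b
  lemma = solve-∀

K-index-step : ∀ a f → (3 + (a + a)) ▷ 2 ▷ 1 ▷ f ≗ 1 ▷ (3 + (suc a + suc a)) ▷ f
K-index-step a f n = begin
  ((3 + (a + a)) ▷ 2 ▷ 1 ▷ f) n        ≡⟨ ▷-▷ (3 + (a + a)) 2 (1 ▷ f) n ⟩
  ((3 + (a + a) + 2) ▷ 1 ▷ f) n        ≡⟨ ▷-exchange (3 + (a + a) + 2) 1 f n ⟩
  (1 ▷ (3 + (a + a) + 2) ▷ f) n        ≡⟨ cong (λ c → (1 ▷ c ▷ f) n) (e a) ⟩
  (1 ▷ (3 + (suc a + suc a)) ▷ f) n    ∎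
  where
  open ≡-Reasoning
  e : ∀ a → 3 + (a + a) + 2 ≡ 3 + (suc a + suc a)
  e = solve-∀

-- The summands of K_a after the first already dominate q K_(a+1), so the first one, q^(3+2a), is
-- left over. At a = 1 this is J_1 = q^5.
K-suc-δ : ∀ a → 1 ▷ K (suc a) 0 ⊕ (3 + (a + a)) ▷ δ ≼ K a 0
K-suc-δ a n = begin
  (1 ▷ K (suc a) 0) n + (c ▷ δ) n
    ≡⟨ +-comm _ ((c ▷ δ) n) ⟩
  (c ▷ δ) n + (1 ▷ K (suc a) 0) n
    ≡⟨ cong ((c ▷ δ) n +_) (K-index-step a (Q (suc a) 0) n) ⟨
  (c ▷ δ) n + (c ▷ 2 ▷ 1 ▷ Q (suc a) 0) n
    ≤⟨ +-monoʳ-≤ ((c ▷ δ) n) (▷-mono c (▷-mono 2 (Q-add-one (suc a) 0)) n) ⟩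
  (c ▷ δ) n + (c ▷ 2 ▷ Q (suc a) 1) n
    ≡⟨ trans (▷-cong c (Q-unfold a 0) n) (▷-⊕ c _ _ n) ⟨
  K a 0 n ∎
  where
  open ≤-Reasoning
  c = 3 + (a + a)

-- The exponent 5 is 3 + 2: the factor q^3 in `K 0 b` times the q^2 that `Q-unfold` puts before the
-- summands after the first.
K-tail-bonus : ∀ b → 5 ▷ (1 ▷ Q 1 b ⊕ E b) ≼ 3 ▷ 2 ▷ Q 1 (suc b)
K-tail-bonus b n = ≤-trans (▷-mono 5 (Q₁-bonus b) n) (≤-reflexive (sym (▷-▷ 3 2 (Q 1 (suc b)) n)))

K-one-E : 1 ▷ K 1 0 ⊕ 5 ▷ E 0 ≼ K 0 0
K-one-E n = begin
  (1 ▷ K 1 0) n + (5 ▷ E 0) n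
    ≡⟨ cong (_+ (5 ▷ E 0) n) (▷-exchange 1 5 (Q 1 0) n) ⟩
  (5 ▷ 1 ▷ Q 1 0) n + (5 ▷ E 0) n
    ≡⟨ ▷-⊕ 5 _ _ n ⟨
  (5 ▷ (1 ▷ Q 1 0 ⊕ E 0)) n
    ≤⟨ K-tail-bonus 0 n ⟩
  (3 ▷ 2 ▷ Q 1 1) n
    ≤⟨ m≤n+m _ ((3 ▷ δ) n) ⟩
  (3 ▷ δ) n + (3 ▷ 2 ▷ Q 1 1) n
    ≡⟨ trans (▷-cong 3 (Q-unfold 0 0) n) (▷-⊕ 3 _ _ n) ⟨
  K 0 0 n ∎
  where open ≤-Reasoning

-- The first summands are compared by `y-add-one`; the remaining ones form a `Q` with first index 1
-- and yield the surplus.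
K-zero-E : ∀ b → 1 ▷ K 0 b ⊕ 5 ▷ E (suc b) ≼ K 0 (suc b)
K-zero-E b n = begin
  (1 ▷ K 0 b) n + (5 ▷ E (suc b)) n
    ≡⟨ cong (_+ (5 ▷ E (suc b)) n) unfold ⟩
  (3 ▷ 1 ▷ y 0 b) n + (5 ▷ 1 ▷ Q 1 (suc b)) n + (5 ▷ E (suc b)) n
    ≡⟨ +-assoc ((3 ▷ 1 ▷ y 0 b) n) _ _ ⟩
  (3 ▷ 1 ▷ y 0 b) n + ((5 ▷ 1 ▷ Q 1 (suc b)) n + (5 ▷ E (suc b)) n)
    ≡⟨ cong ((3 ▷ 1 ▷ y 0 b) n +_) (▷-⊕ 5 _ _ n) ⟨
  (3 ▷ 1 ▷ y 0 b) n + (5 ▷ (1 ▷ Q 1 (suc b) ⊕ E (suc b))) n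
    ≤⟨ +-mono-≤ (▷-mono 3 (y-add-one 0 b) n) (K-tail-bonus (suc b) n) ⟩
  (3 ▷ y 0 (suc b)) n + (3 ▷ 2 ▷ Q 1 (suc (suc b))) n
    ≡⟨ trans (▷-cong 3 (Q-unfold 0 (suc b)) n) (▷-⊕ 3 _ _ n) ⟨
  K 0 (suc b) n ∎
  where
  open ≤-Reasoning
  unfold : (1 ▷ K 0 b) n ≡ (3 ▷ 1 ▷ y 0 b) n + (5 ▷ 1 ▷ Q 1 (suc b)) n
  unfold = begin-equality
    (1 ▷ K 0 b) n
      ≡⟨ ▷-exchange 1 3 (Q 0 b) n ⟩
    (3 ▷ 1 ▷ Q 0 b) n
      ≡⟨ ▷-cong 3 (λ i → trans (▷-cong 1 (Q-unfold 0 b) i) (▷-⊕ 1 _ _ i)) n ⟩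
    (3 ▷ (1 ▷ y 0 b ⊕ 1 ▷ 2 ▷ Q 1 (suc b))) n
      ≡⟨ ▷-⊕ 3 _ _ n ⟩
    (3 ▷ 1 ▷ y 0 b) n + (3 ▷ 1 ▷ 2 ▷ Q 1 (suc b)) n
      ≡⟨ cong ((3 ▷ 1 ▷ y 0 b) n +_) (trans (▷-cong 3 (▷-exchange 1 2 _) n) (▷-▷ 3 2 _ n)) ⟩
    (3 ▷ 1 ▷ y 0 b) n + (5 ▷ 1 ▷ Q 1 (suc b)) n ∎

-- Induction on the exponent along descending ranks

module Descent {I : Set} (down : I → I) (F H K T J : I → Series)
  (F-rec : ∀ m → F m ≗ 1 ▷ F (down m) ⊕ (K m ⊕ 1 ▷ K m) ⊕ T m)
  (H-rec : ∀ m → H m ≗ 1 ▷ H (down m) ⊕ T m)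
  (K-step : ∀ m → 1 ▷ K m ⊕ J (down m) ≼ K (down m))
  where

  -- The surplus accumulated on the way down: Z_m = J_m + q J_(m-1) + q^2 J_(m-2) + ....
  Z : I → Series
  Z m zero = J m zero
  Z m (suc n) = J m (suc n) + Z (down m) n

  Z-unfold : ∀ m → Z m ≗ J m ⊕ 1 ▷ Z (down m)
  Z-unfold m zero = sym (+-identityʳ _)
  Z-unfold m (suc n) = refl

  Z-down : ∀ m n → Z (down m) n ≤ Z m (suc n)
  Z-down m n = m≤n+m _ (J m (suc n))

  J≤Z : ∀ m → J m ≼ Z m
  J≤Z m n = ≤-trans (m≤m+n _ _) (≤-reflexive (sym (Z-unfold m n)))

  -- Without subtraction, this is (1 - q) G_m ≥ K_m + q Z_(m-1) for G_m = F_m - H_m. Since `F-rec`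
  -- and `H-rec` share T_m, G_m = q G_(m-1) + (1 + q) K_m, so (1 - q) G_m = q (1 - q) G_(m-1) + (1 -
  -- q^2) K_m. The bound for m-1 at the previous exponent and K_(m-1) ≥ q K_m + J_(m-1) give the
  -- claim.
  growth : ∀ m → 1 ▷ F m ⊕ H m ⊕ K m ⊕ 1 ▷ Z (down m) ≼ F m ⊕ 1 ▷ H m
  growth m zero = begin
    0 + H m 0 + K m 0 + 0        ≡⟨ cong (λ h → 0 + h + K m 0 + 0) (H-rec m 0) ⟩
    0 + (0 + T m 0) + K m 0 + 0  ≡⟨ lemma (T m 0) (K m 0) ⟩
    0 + (K m 0 + 0) + T m 0 + 0  ≡⟨ cong (_+ 0) (F-rec m 0) ⟨
    F m 0 + 0                    ∎
    where
    open ≤-Reasoning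
    lemma : ∀ t k → 0 + (0 + t) + k + 0 ≡ 0 + (k + 0) + t + 0
    lemma = solve-∀
  growth m (suc n) = begin
    F m n + H m (suc n) + K m (suc n) + Z m′ n
      ≡⟨ cong₂ (λ f z → f + H m (suc n) + K m (suc n) + z) (F-rec m n) (Z-unfold m′ n) ⟩
    (f + (K m n + k) + T m n) + H m (suc n) + K m (suc n) + (J m′ n + z)
      ≡⟨ cong (λ h → (f + (K m n + k) + T m n) + h + K m (suc n) + (J m′ n + z)) (H-rec m (suc n)) ⟩
    (f + (K m n + k) + T m n) + (H m′ n + T m (suc n)) + K m (suc n) + (J m′ n + z)
      ≡⟨ lemma₁ f (K m n) k (T m n) (H m′ n) (T m (suc n)) (K m (suc n)) (J m′ n) z ⟩
    (f + H m′ n + (k + J m′ n) + z) + (K m (suc n) + K m n + T m (suc n) + T m n)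
      -- q K_m + J_(m-1) is replaced by K_(m-1), the form in which the induction hypothesis applies.
      ≤⟨ +-monoˡ-≤ _ (+-monoˡ-≤ z (+-monoʳ-≤ (f + H m′ n) (K-step m n))) ⟩
    (f + H m′ n + K m′ n + z) + (K m (suc n) + K m n + T m (suc n) + T m n)
      ≤⟨ +-monoˡ-≤ _ (growth m′ n) ⟩
    (F m′ n + h) + (K m (suc n) + K m n + T m (suc n) + T m n)
      ≡⟨ lemma₂ (F m′ n) h (K m (suc n)) (K m n) (T m (suc n)) (T m n) ⟩
    (F m′ n + (K m (suc n) + K m n) + T m (suc n)) + (h + T m n)
      ≡⟨ cong₂ _+_ (F-rec m (suc n)) (H-rec m n) ⟨
    F m (suc n) + H m n ∎
    where
    open ≤-Reasoning
    m′ = down m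
    f = (1 ▷ F m′) n
    k = (1 ▷ K m) n
    h = (1 ▷ H m′) n
    z = (1 ▷ Z (down m′)) n
    lemma₁ : ∀ f K₀ k T₀ h T₁ K₁ j z →
      (f + (K₀ + k) + T₀) + (h + T₁) + K₁ + (j + z) ≡ (f + h + (k + j) + z) + (K₁ + K₀ + T₁ + T₀)
    lemma₁ = solve-∀
    lemma₂ : ∀ F h K₁ K₀ T₁ T₀ → (F + h) + (K₁ + K₀ + T₁ + T₀) ≡ (F + (K₁ + K₀) + T₁) + (h + T₀)
    lemma₂ = solve-∀

-- alt = 1 / (1 - q²)
alt : Series
alt zero = 1
alt (suc zero) = 0
alt (suc (suc n)) = alt n

alt-unfold : alt ≗ 2 ▷ alt ⊕ δ
alt-unfold zero = refl
alt-unfold (suc zero) = refl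
alt-unfold (suc (suc n)) = sym (+-identityʳ _)

-- The families at all integer ranks

down : ℤ → ℤ
down (pos (suc a)) = pos a
down (pos zero) = negsuc 0
down (negsuc b) = negsuc (suc b)

-- `negsuc b` is m = -(b+1), so that |m|+1 = 1-m = 2+b there.
Fᶻ Hᶻ Kᶻ Tᶻ Jᶻ : ℤ → Series
Fᶻ (pos a) = F a 0
Fᶻ (negsuc b) = F 0 (suc b)
Hᶻ (pos a) = suc a ▷ alt
Hᶻ (negsuc b) = (2 + b) ▷ alt
Kᶻ (pos a) = K a 0
Kᶻ (negsuc b) = K 0 (suc b)
Tᶻ (pos zero) = 1 ▷ δ
Tᶻ (pos (suc a)) = 𝟘
Tᶻ (negsuc b) = (2 + b) ▷ δ
Jᶻ (pos zero) = 5 ▷ E 0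
Jᶻ (pos (suc zero)) = 5 ▷ δ
Jᶻ (pos (suc (suc a))) = 𝟘
Jᶻ (negsuc b) = 5 ▷ E (suc b)

F-rec : ∀ m → Fᶻ m ≗ 1 ▷ Fᶻ (down m) ⊕ (Kᶻ m ⊕ 1 ▷ Kᶻ m) ⊕ Tᶻ m
F-rec (pos zero) = F-zero 0
F-rec (pos (suc a)) n = trans (F-suc a n) (sym (+-identityʳ _))
F-rec (negsuc b) = F-zero (suc b)

-- For m ≥ 1 the exponent |m|+1 drops by one with m. For m ≤ 0 it grows, so q H_(m-1) = q^2 H_m, and
-- 1/(1 - q^2) = q^2/(1 - q^2) + 1 leaves q^(|m|+1) = T_m.
H-rec : ∀ m → Hᶻ m ≗ 1 ▷ Hᶻ (down m) ⊕ Tᶻ m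
H-rec (pos (suc a)) n = trans (sym (▷-▷ 1 (suc a) alt n)) (sym (+-identityʳ _))
H-rec (pos zero) n = begin
  (1 ▷ alt) n                  ≡⟨ ▷-cong 1 alt-unfold n ⟩
  (1 ▷ (2 ▷ alt ⊕ δ)) n        ≡⟨ ▷-⊕ 1 _ _ n ⟩
  (1 ▷ 2 ▷ alt) n + (1 ▷ δ) n  ∎
  where open ≡-Reasoning
H-rec (negsuc b) n = begin
  (c ▷ alt) n                        ≡⟨ ▷-cong c alt-unfold n ⟩
  (c ▷ (2 ▷ alt ⊕ δ)) n              ≡⟨ ▷-⊕ c _ _ n ⟩
  (c ▷ 2 ▷ alt) n + (c ▷ δ) n        ≡⟨ cong (_+ (c ▷ δ) n) (▷-▷ c 2 alt n) ⟩
  ((c + 2) ▷ alt) n + (c ▷ δ) n      ≡⟨ cong (λ d → (d ▷ alt) n + (c ▷ δ) n) (+-comm c 2) ⟩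
  ((2 + c) ▷ alt) n + (c ▷ δ) n      ≡⟨ cong (_+ (c ▷ δ) n) (▷-▷ 1 (suc c) alt n) ⟨
  (1 ▷ (suc c) ▷ alt) n + (c ▷ δ) n  ∎
  where
  open ≡-Reasoning
  c = 2 + b

K-suc-J : ∀ a → 1 ▷ K (suc a) 0 ⊕ Jᶻ (pos a) ≼ K a 0
K-suc-J zero = K-one-E
K-suc-J (suc zero) = K-suc-δ 1
K-suc-J (suc (suc a)) n = ≤-trans (+-monoʳ-≤ _ z≤n) (K-suc-δ (2 + a) n)

K-step : ∀ m → 1 ▷ Kᶻ m ⊕ Jᶻ (down m) ≼ Kᶻ (down m)
K-step (pos zero) = K-zero-E 0
K-step (pos (suc a)) = K-suc-J a
K-step (negsuc b) = K-zero-E (suc b)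

open Descent down Fᶻ Hᶻ Kᶻ Tᶻ Jᶻ F-rec H-rec K-step

-- Surpluses outweighing the terms H_m

neg : ℕ → ℤ
neg zero = pos 0
neg (suc b) = negsuc b

J-neg : ∀ w → Jᶻ (neg w) ≗ 5 ▷ E w
J-neg zero n = refl
J-neg (suc w) n = refl

Z-neg : ∀ w n → Z (neg (suc w)) n ≤ Z (neg w) (suc n)
Z-neg zero = Z-down (pos 0)
Z-neg (suc w) = Z-down (negsuc w)

-- J_(-w) has exponents 6+3w and 8+3w, which settles d = 0 and d = 2; for odd d the left side is 0.
-- Passing to w+1 raises the exponents by 3 and `Z-neg` adds one more, so the next pair lands at d =
-- 4 and d = 6.
alt≤Z : ∀ d w → alt d ≤ Z (neg w) (6 + w * 3 + d)
alt≤Z 0 w = begin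
  1                             ≡⟨ ▷-δ (1 + w * 3) ⟨
  ((1 + w * 3) ▷ δ) (1 + w * 3) ≤⟨ m≤m+n _ _ ⟩
  E w (1 + w * 3)               ≡⟨ J-neg w (6 + w * 3) ⟨
  Jᶻ (neg w) (6 + w * 3)        ≤⟨ J≤Z (neg w) _ ⟩
  Z (neg w) (6 + w * 3)         ≡⟨ cong (Z (neg w)) (+-identityʳ (6 + w * 3)) ⟨
  Z (neg w) (6 + w * 3 + 0)     ∎
  where open ≤-Reasoning
alt≤Z 1 w = z≤n
alt≤Z 2 w = begin
  1                             ≡⟨ ▷-δ (3 + w * 3) ⟨
  ((3 + w * 3) ▷ δ) (3 + w * 3) ≤⟨ m≤n+m _ _ ⟩
  E w (3 + w * 3)               ≡⟨ J-neg w (8 + w * 3) ⟨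
  Jᶻ (neg w) (8 + w * 3)        ≤⟨ J≤Z (neg w) _ ⟩
  Z (neg w) (8 + w * 3)         ≡⟨ cong (Z (neg w)) (+-comm 2 (6 + w * 3)) ⟩
  Z (neg w) (6 + w * 3 + 2)     ∎
  where open ≤-Reasoning
alt≤Z 3 w = z≤n
alt≤Z (suc (suc (suc (suc d)))) w = begin
  alt d                               ≤⟨ alt≤Z d (suc w) ⟩
  Z (neg (suc w)) (9 + w * 3 + d)     ≤⟨ Z-neg w _ ⟩
  Z (neg w) (10 + w * 3 + d)          ≡⟨ cong (Z (neg w)) (lemma w d) ⟩
  Z (neg w) (6 + w * 3 + (4 + d))     ∎
  where
  open ≤-Reasoning
  lemma : ∀ w d → 10 + w * 3 + d ≡ 6 + w * 3 + (4 + d)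
  lemma = solve-∀

Z-pos : ∀ a c n → Z (pos c) n ≤ Z (pos (a + c)) (a + n)
Z-pos zero c n = ≤-refl
Z-pos (suc a) c n = ≤-trans (Z-pos a c n) (Z-down (pos (suc a + c)) (a + n))

-- Here d measures how far n lies beyond m+2, with m = a. J_1 pays for d = 2 once a ≥ 1; J_0,
-- J_(-1), ... pay from d = 4 on. The excluded cases are n = m+2 and (m,n) = (0,4).
alt≤Z-pos : ∀ a d → d ≢ 0 → ¬ (a ≡ 0 × d ≡ 2) → alt d ≤ Z (pos a) (a + (2 + d))
alt≤Z-pos a 0 d≢0 _ = contradiction refl d≢0
alt≤Z-pos a 1 _ _ = z≤n
alt≤Z-pos zero 2 _ ¬e = contradiction (refl , refl) ¬e
-- `Z (pos 1) 5` evaluates to 1, the coefficient of q^5 in J_1.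
alt≤Z-pos (suc a) 2 _ _ = subst₂ (λ c n → 1 ≤ Z (pos c) n) (+-comm a 1) (+-suc a 4) (Z-pos a 1 5)
alt≤Z-pos a 3 _ _ = z≤n
alt≤Z-pos a (suc (suc (suc (suc d)))) _ _ = begin
  alt d                         ≤⟨ alt≤Z d 0 ⟩
  Z (pos 0) (6 + d)             ≤⟨ Z-pos a 0 (6 + d) ⟩
  Z (pos (a + 0)) (a + (6 + d)) ≡⟨ cong (λ c → Z (pos c) (a + (6 + d))) (+-identityʳ a) ⟩
  Z (pos a) (a + (6 + d))       ∎
  where open ≤-Reasoning

▷-shifted : ∀ c f d → (c ▷ f) (c + d) ≡ f d
▷-shifted zero f d = refl
▷-shifted (suc c) f d = ▷-shifted c f d

H≤Z : ∀ a n → suc n ≢ a + 2 → ¬ (a ≡ 0 × suc n ≡ 4) → (suc a ▷ alt) n ≤ Z (pos a) (suc n)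
H≤Z a n n≢ ¬e with suc a ≤? n
... | no a≮n = ≤-trans (≤-reflexive (▷-below (suc a) alt (≰⇒> a≮n))) z≤n
... | yes a<n with m≤n⇒∃[o]m+o≡n a<n
... | d , refl = begin
  (suc a ▷ alt) (suc a + d)  ≡⟨ ▷-shifted (suc a) alt d ⟩
  alt d                      ≤⟨ alt≤Z-pos a d d≢0 ¬2 ⟩
  Z (pos a) (a + (2 + d))    ≡⟨ cong (Z (pos a)) (lemma a d) ⟩
  Z (pos a) (2 + (a + d))    ∎
  where
  open ≤-Reasoning
  lemma : ∀ a d → a + (2 + d) ≡ 2 + (a + d)
  lemma = solve-∀
  d≢0 : d ≢ 0
  d≢0 refl = n≢ (sym (lemma a 0))
  ¬2 : ¬ (a ≡ 0 × d ≡ 2)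
  ¬2 (refl , refl) = ¬e (refl , refl)

-- `growth` supplies K_m and q Z_(m-1). As J_m ≤ K_m for m ≥ 0, together they dominate Z_m, which
-- outweighs the q H_m on the other side.
F-mono : ∀ a n → suc n ≢ a + 2 → ¬ (a ≡ 0 × suc n ≡ 4) → F a 0 n ≤ F a 0 (suc n)
F-mono a n n≢ ¬e = +-cancelʳ-≤ h _ _ (begin
  F a 0 n + h
    ≤⟨ +-monoʳ-≤ (F a 0 n) (H≤Z a n n≢ ¬e) ⟩
  F a 0 n + (Jᶻ (pos a) (suc n) + Z (down (pos a)) n)
    ≡⟨ +-assoc (F a 0 n) _ _ ⟨
  F a 0 n + Jᶻ (pos a) (suc n) + Z (down (pos a)) n
    -- `(a ▷ alt) n` is the coefficient of q^(n+1) in H_m, which stands on the left in `growth`.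
    ≤⟨ +-monoˡ-≤ _ (+-mono-≤ (m≤m+n (F a 0 n) ((a ▷ alt) n)) (J≤K (suc n))) ⟩
  F a 0 n + (a ▷ alt) n + K a 0 (suc n) + Z (down (pos a)) n
    ≤⟨ growth (pos a) (suc n) ⟩
  F a 0 (suc n) + h ∎)
  where
  open ≤-Reasoning
  h = (suc a ▷ alt) n
  J≤K : Jᶻ (pos a) ≼ K a 0
  J≤K i = ≤-trans (m≤n+m _ _) (K-suc-J a i)

-- Terms with k ≥ n vanish because their shift exceeds n. In F_m, k is the number of parts after the
-- first.
S-as-sum : ∀ c g n → (suc c ▷ S g) n ≡ Σ< n (λ k → ((suc c + k) ▷ g k) n)
S-as-sum c g zero = refl
S-as-sum zero g (suc n) = S-Σ n g
  where
  S-Σ : ∀ n g → S g n ≡ Σ< (suc n) (λ k → (k ▷ g k) n)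
  S-Σ zero g = refl
  S-Σ (suc n) g = begin
    g 0 (suc n) + S (λ j → g (suc j)) n
      ≡⟨ cong (g 0 (suc n) +_) (S-Σ n (λ j → g (suc j))) ⟩
    g 0 (suc n) + Σ< (suc n) (λ k → (k ▷ g (suc k)) n)
      ≡⟨ Σ<-shift (suc n) (λ k → (k ▷ g k) (suc n)) ⟨
    Σ< (suc (suc n)) (λ k → (k ▷ g k) (suc n)) ∎
    where open ≡-Reasoning
S-as-sum (suc c) g (suc n) = begin
  (suc c ▷ S g) n
    ≡⟨ S-as-sum c g n ⟩
  Σ< n (λ k → ((suc c + k) ▷ g k) n)
    ≡⟨ +-identityʳ _ ⟨
  Σ< n (λ k → ((suc c + k) ▷ g k) n) + 0
    ≡⟨ cong (Σ< n (λ k → ((suc c + k) ▷ g k) n) +_) (▷-below (suc c + n) (g n) (s≤s (m≤n+m n c))) ⟨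
  Σ< n (λ k → ((suc c + k) ▷ g k) n) + ((suc c + n) ▷ g n) n ∎
  where open ≡-Reasoning

private variable
  A B : Set

-- Counting overpartitions by their first part
total : (A → ℕ) → List A → ℕ
total w [] = 0
total w (x ∷ xs) = w x + total w xs

total-cong : {w w′ : A → ℕ} → w ≗ w′ → total w ≗ total w′
total-cong e [] = refl
total-cong e (x ∷ xs) = cong₂ _+_ (e x) (total-cong e xs)

total-++ : (w : A → ℕ) (xs ys : List A) → total w (xs ++ ys) ≡ total w xs + total w ys
total-++ w [] ys = refl
total-++ w (x ∷ xs) ys = trans (cong (w x +_) (total-++ w xs ys)) (sym (+-assoc (w x) _ _))

total-map : (w : B → ℕ) (f : A → B) (xs : List A) → total w (map f xs) ≡ total (w ∘ f) xs
total-map w f [] = refl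
total-map w f (x ∷ xs) = cong (w (f x) +_) (total-map w f xs)

total-concatMap : (w : B → ℕ) (f : A → List B) (xs : List A) →
  total w (concatMap f xs) ≡ total (λ x → total w (f x)) xs
total-concatMap w f [] = refl
total-concatMap w f (x ∷ xs) =
  trans (total-++ w (f x) _) (cong (total w (f x) +_) (total-concatMap w f xs))

total-* : ∀ c (w : A → ℕ) (xs : List A) → total (λ x → c * w x) xs ≡ c * total w xs
total-* c w [] = sym (*-zeroʳ c)
total-* c w (x ∷ xs) = trans (cong (c * w x +_) (total-* c w xs)) (sym (*-distribˡ-+ c (w x) _))

total-0 : (xs : List A) → total (λ _ → 0) xs ≡ 0
total-0 [] = refl
total-0 (x ∷ xs) = total-0 xs

total-upTo : ∀ n w → total w (upTo n) ≡ Σ< n w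
total-upTo zero w = refl
total-upTo (suc n) w = begin
  total w (upTo (suc n))       ≡⟨ cong (total w) (upTo-∷ʳ n) ⟨
  total w (upTo n ++ n ∷ [])   ≡⟨ total-++ w (upTo n) _ ⟩
  total w (upTo n) + (w n + 0) ≡⟨ cong₂ _+_ (total-upTo n w) (+-identityʳ (w n)) ⟩
  Σ< n w + w n                 ∎
  where open ≡-Reasoning

ind : Bool → ℕ
ind b = if b then 1 else 0

total-filter : ∀ {p} {P : Pred A p} (P? : Decidable P) (w : A → ℕ) (xs : List A) →
  total w (filter P? xs) ≡ total (λ x → ind (does (P? x)) * w x) xs
total-filter P? w [] = refl
total-filter P? w (x ∷ xs) with does (P? x)
... | true = cong₂ _+_ (sym (*-identityˡ (w x))) (total-filter P? w xs)
... | false = total-filter P? w xs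

length-total : (xs : List A) → length xs ≡ total (λ _ → 1) xs
length-total [] = refl
length-total (x ∷ xs) = cong suc (length-total xs)

total-listsOfLength-cong : ∀ k (xs : List A) {w w′ : List A → ℕ} →
  (∀ l → length l ≡ k → w l ≡ w′ l) → total w (listsOfLength k xs) ≡ total w′ (listsOfLength k xs)
total-listsOfLength-cong zero xs e = cong (_+ 0) (e [] refl)
total-listsOfLength-cong (suc k) xs {w} {w′} e = begin
  total w (listsOfLength (suc k) xs)
    ≡⟨ total-concatMap w _ xs ⟩
  total (λ x → total w (map (x ∷_) (listsOfLength k xs))) xs
    ≡⟨ total-cong step xs ⟩
  total (λ x → total w′ (map (x ∷_) (listsOfLength k xs))) xs
    ≡⟨ total-concatMap w′ _ xs ⟨
  total w′ (listsOfLength (suc k) xs) ∎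
  where
  open ≡-Reasoning
  step : ∀ x → total w (map (x ∷_) (listsOfLength k xs)) ≡ total w′ (map (x ∷_) (listsOfLength k xs))
  step x = begin
    total w (map (x ∷_) (listsOfLength k xs))   ≡⟨ total-map w (x ∷_) (listsOfLength k xs) ⟩
    total (w ∘ (x ∷_)) (listsOfLength k xs)     ≡⟨ total-listsOfLength-cong k xs (λ l |l| → e (x ∷ l) (cong suc |l|)) ⟩
    total (w′ ∘ (x ∷_)) (listsOfLength k xs)    ≡⟨ total-map w′ (x ∷_) (listsOfLength k xs) ⟨
    total w′ (map (x ∷_) (listsOfLength k xs))  ∎

-- A global name for the local list inside `candidates`, with the same definition.
parts : ℕ → List (ℕ × Bool)
parts n = concatMap (λ i → (suc i , false) ∷ (suc i , true) ∷ []) (upTo n)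

total-parts : ∀ n w → total w (parts n) ≡ Σ< n (λ i → w (suc i , false) + w (suc i , true))
total-parts n w = begin
  total w (parts n)
    ≡⟨ total-concatMap w _ (upTo n) ⟩
  total (λ i → w (suc i , false) + (w (suc i , true) + 0)) (upTo n)
    ≡⟨ total-upTo n _ ⟩
  Σ< n (λ i → w (suc i , false) + (w (suc i , true) + 0))
    ≡⟨ Σ<-cong n (λ i _ → cong (w (suc i , false) +_) (+-identityʳ _)) ⟩
  Σ< n (λ i → w (suc i , false) + w (suc i , true)) ∎
  where open ≡-Reasoning

total-listsOfLength-suc : ∀ N k w → total w (listsOfLength (suc k) (parts N))
  ≡ Σ< N (λ i → total (λ l → w ((suc i , false) ∷ l)) (listsOfLength k (parts N))
              + total (λ l → w ((suc i , true) ∷ l)) (listsOfLength k (parts N)))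
total-listsOfLength-suc N k w = begin
  total w (listsOfLength (suc k) (parts N))
    ≡⟨ total-concatMap w _ (parts N) ⟩
  total (λ x → total w (map (x ∷_) (listsOfLength k (parts N)))) (parts N)
    ≡⟨ total-cong (λ x → total-map w (x ∷_) (listsOfLength k (parts N))) (parts N) ⟩
  total (λ x → total (w ∘ (x ∷_)) (listsOfLength k (parts N))) (parts N)
    ≡⟨ total-parts N _ ⟩
  _ ∎
  where open ≡-Reasoning

-- Enumerated tails and the series `v`

size : Overpartition → ℕ
size l = sum (map proj₁ l)

total-▷ : ∀ c s (φ : Overpartition → Bool) xs →
  total (λ l → ind ((c + size l ≡ᵇ s) ∧ φ l)) xs ≡ (c ▷ (λ t → total (λ l → ind ((size l ≡ᵇ t) ∧ φ l)) xs)) s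
total-▷ zero s φ xs = refl
total-▷ (suc c) zero φ xs = total-0 xs
total-▷ (suc c) (suc s) φ xs = total-▷ c s φ xs

Σ<-+ : ∀ n (f g : ℕ → ℕ) → Σ< n (λ i → f i + g i) ≡ Σ< n f + Σ< n g
Σ<-+ zero f g = refl
Σ<-+ (suc n) f g = trans (cong (_+ (f n + g n)) (Σ<-+ n f g)) (interchange (Σ< n f) (Σ< n g) (f n) (g n))

Σ<-0 : ∀ n {f : ℕ → ℕ} → (∀ i → i < n → f i ≡ 0) → Σ< n f ≡ 0
Σ<-0 zero e = refl
Σ<-0 (suc n) e = cong₂ _+_ (Σ<-0 n (λ i i<n → e i (m<n⇒m<1+n i<n))) (e n ≤-refl)

ind-< : ∀ {i q} → i < q → ind (i <ᵇ q) ≡ 1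
ind-< {zero} (s≤s _) = refl
ind-< {suc i} (s≤s i<q) = ind-< i<q

ind-≮ : ∀ {i q} → q ≤ i → ind (i <ᵇ q) ≡ 0
ind-≮ z≤n = refl
ind-≮ (s≤s q≤i) = ind-≮ q≤i

ind-≡ : ∀ i → ind (i ≡ᵇ i) ≡ 1
ind-≡ zero = refl
ind-≡ (suc i) = ind-≡ i

ind-≢ : ∀ {i j} → i < j → ind (i ≡ᵇ j) ≡ 0
ind-≢ {zero} (s≤s _) = refl
ind-≢ {suc i} (s≤s i<j) = ind-≢ i<j

ind-≢′ : ∀ {i j} → j < i → ind (i ≡ᵇ j) ≡ 0
ind-≢′ {j = zero} (s≤s _) = refl
ind-≢′ {j = suc j} (s≤s j<i) = ind-≢′ j<i

Σ<-restrict : ∀ {q} N (X : ℕ → ℕ) → q ≤ N → Σ< N (λ i → ind (i <ᵇ q) * X i) ≡ Σ< q X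
Σ<-restrict {q} N X q≤N with m≤n⇒m<n∨m≡n q≤N
... | inj₂ refl = Σ<-cong q (λ i i<q → trans (cong (_* X i) (ind-< i<q)) (*-identityˡ (X i)))
Σ<-restrict (suc N) X _ | inj₁ (s≤s q≤N) =
  trans (cong₂ _+_ (Σ<-restrict N X q≤N) (cong (_* X N) (ind-≮ q≤N))) (+-identityʳ _)

Σ<-select : ∀ N j (X : ℕ → ℕ) → (N ≤ j → X j ≡ 0) → Σ< N (λ i → ind (i ≡ᵇ j) * X i) ≡ X j
Σ<-select N j X e with j <? N
... | no j≮N = trans (Σ<-0 N (λ i i<N → cong (_* X i) (ind-≢ (<-≤-trans i<N (≮⇒≥ j≮N))))) (sym (e (≮⇒≥ j≮N)))
Σ<-select (suc N) j X e | yes (s≤s j≤N) with m≤n⇒m<n∨m≡n j≤N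
... | inj₁ j<N = trans
  (cong₂ _+_ (Σ<-select N j X (λ N≤j → contradiction j<N (≤⇒≯ N≤j))) (cong (_* X N) (ind-≢′ j<N)))
  (+-identityʳ _)
... | inj₂ refl = cong₂ _+_
  (Σ<-0 N (λ i i<N → cong (_* X i) (ind-≢ i<N)))
  (trans (cong (_* X N) (ind-≡ N)) (*-identityˡ (X N)))

u : ℕ → ℕ → ℕ → Series
u N p k s = total (λ l → ind ((size l ≡ᵇ s) ∧ validFrom (suc p) l)) (listsOfLength k (parts N))

ind-∧-* : ∀ a b c → ind (a ∧ (b ∧ c)) ≡ ind b * ind (a ∧ c)
ind-∧-* false false c = refl
ind-∧-* false true c = refl
ind-∧-* true false c = refl
ind-∧-* true true c = sym (+-identityʳ _)

<ᵇ-suc-∧ : ∀ i p c → (i <ᵇ suc p) ∧ ((i <ᵇ p) ∧ c) ≡ (i <ᵇ p) ∧ c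
<ᵇ-suc-∧ zero zero c = refl
<ᵇ-suc-∧ zero (suc p) c = refl
<ᵇ-suc-∧ (suc i) zero c = refl
<ᵇ-suc-∧ (suc i) (suc p) c = <ᵇ-suc-∧ i p c

-- As p < N, every part allowed after p+1 occurs in `parts N`. Splitting off the head gives the two
-- sums of `v`: non-overlined parts up to p+1 and overlined parts up to p.
u≗v : ∀ N k p → p < N → u N p k ≗ v p k
u≗v N zero p p<N zero = refl
u≗v N zero p p<N (suc s) = refl
u≗v N (suc k) p p<N s = begin
  u N p (suc k) s
    ≡⟨ total-listsOfLength-suc N k _ ⟩
  Σ< N (λ i → total (λ l → ind ((suc i + size l ≡ᵇ s) ∧ ((i <ᵇ suc p) ∧ validFrom (suc i) l))) ls
            + total (λ l → ind ((suc i + size l ≡ᵇ s) ∧ ((i <ᵇ suc p) ∧ ((i <ᵇ p) ∧ validFrom (suc i) l)))) ls)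
    ≡⟨ Σ<-cong N (λ i i<N → cong₂ _+_ (restrict i (i <ᵇ suc p) i<N) (trans (total-cong (drop-redundant i) ls) (restrict i (i <ᵇ p) i<N))) ⟩
  Σ< N (λ i → ind (i <ᵇ suc p) * (suc i ▷ v i k) s + ind (i <ᵇ p) * (suc i ▷ v i k) s)
    ≡⟨ Σ<-+ N _ _ ⟩
  Σ< N (λ i → ind (i <ᵇ suc p) * (suc i ▷ v i k) s) + Σ< N (λ i → ind (i <ᵇ p) * (suc i ▷ v i k) s)
    ≡⟨ cong₂ _+_ (Σ<-restrict N _ p<N) (Σ<-restrict N _ (<⇒≤ p<N)) ⟩
  v p (suc k) s ∎
  where
  open ≡-Reasoning
  ls = listsOfLength k (parts N)
  drop-redundant : ∀ i l → ind ((suc i + size l ≡ᵇ s) ∧ ((i <ᵇ suc p) ∧ ((i <ᵇ p) ∧ validFrom (suc i) l)))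
    ≡ ind ((suc i + size l ≡ᵇ s) ∧ ((i <ᵇ p) ∧ validFrom (suc i) l))
  drop-redundant i l = cong (λ b → ind ((suc i + size l ≡ᵇ s) ∧ b)) (<ᵇ-suc-∧ i p (validFrom (suc i) l))
  restrict : ∀ i b → i < N →
    total (λ l → ind ((suc i + size l ≡ᵇ s) ∧ (b ∧ validFrom (suc i) l))) ls ≡ ind b * (suc i ▷ v i k) s
  restrict i b i<N = begin
    total (λ l → ind ((suc i + size l ≡ᵇ s) ∧ (b ∧ validFrom (suc i) l))) ls
      ≡⟨ total-cong (λ l → ind-∧-* (suc i + size l ≡ᵇ s) b _) ls ⟩
    total (λ l → ind b * ind ((suc i + size l ≡ᵇ s) ∧ validFrom (suc i) l)) ls
      ≡⟨ total-* (ind b) _ ls ⟩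
    ind b * total (λ l → ind ((suc i + size l ≡ᵇ s) ∧ validFrom (suc i) l)) ls
      ≡⟨ cong (ind b *_) (total-▷ (suc i) s (validFrom (suc i)) ls) ⟩
    ind b * (suc i ▷ u N i k) s
      ≡⟨ cong (ind b *_) (▷-cong (suc i) (u≗v N k i i<N) s) ⟩
    ind b * (suc i ▷ v i k) s ∎

-- The D-rank count as a coefficient of F_m

rank-≟ : ∀ i k m → does (pos (suc i) ℤ.- pos (suc k) ℤ.≟ pos m) ≡ (i ≡ᵇ m + k)
rank-≟ i k m = does-⇔ (mk⇔ to from) (_ ℤ.≟ _) (i ℕ.≟ m + k)
  where
  add-back : ∀ x z → (x ℤ.- z) ℤ.+ z ≡ x
  add-back = ℤ-Solver.solve-∀
  cancel : ∀ x z → (x ℤ.+ z) ℤ.- z ≡ x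
  cancel = ℤ-Solver.solve-∀
  to : pos (suc i) ℤ.- pos (suc k) ≡ pos m → i ≡ m + k
  to e = suc-injective (trans (ℤP.+-injective (trans (sym (add-back (pos (suc i)) (pos (suc k)))) (cong (ℤ._+ pos (suc k)) e))) (+-suc m k))
  from : i ≡ m + k → pos (suc i) ℤ.- pos (suc k) ≡ pos m
  from refl = trans (cong (λ x → pos x ℤ.- pos (suc k)) (sym (+-suc m k))) (cancel (pos m) (pos (suc k)))

does-≟-true : ∀ b → does (b Bool.≟ true) ≡ b
does-≟-true false = refl
does-≟-true true = refl

countWith-total : ∀ r m N → countWith r m N
  ≡ Σ< (suc N) (λ k → total (λ l → ind (isOverpartitionOf N l) * ind (does (r l ℤ.≟ m))) (listsOfLength k (parts N)))
countWith-total r m N = begin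
  countWith r m N
    ≡⟨ length-total (filter (λ l → r l ℤ.≟ m) (overpartitions N)) ⟩
  total (λ _ → 1) (filter (λ l → r l ℤ.≟ m) (overpartitions N))
    ≡⟨ total-filter (λ l → r l ℤ.≟ m) _ (overpartitions N) ⟩
  total (λ l → ind (does (r l ℤ.≟ m)) * 1) (overpartitions N)
    ≡⟨ total-filter (λ l → isOverpartitionOf N l Bool.≟ true) _ (candidates N) ⟩
  total (λ l → ind (does (isOverpartitionOf N l Bool.≟ true)) * (ind (does (r l ℤ.≟ m)) * 1)) (candidates N)
    ≡⟨ total-cong (λ l → cong₂ _*_ (cong ind (does-≟-true (isOverpartitionOf N l))) (*-identityʳ (ind (does (r l ℤ.≟ m))))) (candidates N) ⟩
  total w (candidates N)
    ≡⟨ total-concatMap w (λ k → listsOfLength k (parts N)) (upTo (suc N)) ⟩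
  total (λ k → total w (listsOfLength k (parts N))) (upTo (suc N))
    ≡⟨ total-upTo (suc N) _ ⟩
  Σ< (suc N) (λ k → total w (listsOfLength k (parts N))) ∎
  where
  open ≡-Reasoning
  w : Overpartition → ℕ
  w l = ind (isOverpartitionOf N l) * ind (does (r l ℤ.≟ m))

-- Rank m with k parts after the first forces the first part to be m+k+1. Overlining it affects
-- neither the rank nor what may follow, hence the factor 2.
Nbar-F : ∀ m n → Nbar (pos m) (pos (suc n)) ≡ F m 0 (suc n) + F m 0 (suc n)
Nbar-F m n = begin
  Nbar (pos m) (pos N)
    ≡⟨ countWith-total dRank (pos m) N ⟩
  Σ< (suc N) (λ k → total w (listsOfLength k (parts N)))
    -- Length 0 contributes only the empty list, whose weight reduces to 0 because N is positive.
    ≡⟨ Σ<-shift N _ ⟩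
  Σ< N (λ k → total w (listsOfLength (suc k) (parts N)))
    ≡⟨ Σ<-cong N (λ k _ → by-length k) ⟩
  Σ< N (λ k → X k + X k)
    ≡⟨ Σ<-+ N X X ⟩
  Σ< N X + Σ< N X
    ≡⟨ cong₂ _+_ (S-as-sum m _ N) (S-as-sum m _ N) ⟨
  F m 0 N + F m 0 N ∎
  where
  open ≡-Reasoning
  N = suc n
  w : Overpartition → ℕ
  w l = ind (isOverpartitionOf N l) * ind (does (dRank l ℤ.≟ pos m))
  X : ℕ → ℕ
  X k = (suc (m + k) ▷ v (m + k) k) N
  by-head : ∀ k i o → i < N → total (λ l → w ((suc i , o) ∷ l)) (listsOfLength k (parts N))
    ≡ ind (i ≡ᵇ m + k) * (suc i ▷ v i k) N
  by-head k i o i<N = begin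
    total (λ l → w ((suc i , o) ∷ l)) ls
      ≡⟨ total-listsOfLength-cong k (parts N) rank-of-length ⟩
    total (λ l → ind (i ≡ᵇ m + k) * ind ((suc i + size l ≡ᵇ N) ∧ validFrom (suc i) l)) ls
      ≡⟨ total-* (ind (i ≡ᵇ m + k)) _ ls ⟩
    ind (i ≡ᵇ m + k) * total (λ l → ind ((suc i + size l ≡ᵇ N) ∧ validFrom (suc i) l)) ls
      ≡⟨ cong (ind (i ≡ᵇ m + k) *_) (trans (total-▷ (suc i) N _ ls) (▷-cong (suc i) (u≗v N k i i<N) N)) ⟩
    ind (i ≡ᵇ m + k) * (suc i ▷ v i k) N ∎
    where
    ls = listsOfLength k (parts N)
    rank-of-length : ∀ l → length l ≡ k →
      w ((suc i , o) ∷ l) ≡ ind (i ≡ᵇ m + k) * ind ((suc i + size l ≡ᵇ N) ∧ validFrom (suc i) l)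
    rank-of-length l refl = trans (*-comm (ind (isOverpartitionOf N ((suc i , o) ∷ l))) _)
      (cong (λ b → ind b * ind ((suc i + size l ≡ᵇ N) ∧ validFrom (suc i) l)) (rank-≟ i (length l) m))
  by-length : ∀ k → total w (listsOfLength (suc k) (parts N)) ≡ X k + X k
  by-length k = begin
    total w (listsOfLength (suc k) (parts N))
      ≡⟨ total-listsOfLength-suc N k w ⟩
    _
      ≡⟨ Σ<-cong N (λ i i<N → cong₂ _+_ (by-head k i false i<N) (by-head k i true i<N)) ⟩
    Σ< N (λ i → ind (i ≡ᵇ m + k) * (suc i ▷ v i k) N + ind (i ≡ᵇ m + k) * (suc i ▷ v i k) N)
      ≡⟨ Σ<-+ N _ _ ⟩
    Σ< N (λ i → ind (i ≡ᵇ m + k) * (suc i ▷ v i k) N) + Σ< N (λ i → ind (i ≡ᵇ m + k) * (suc i ▷ v i k) N)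
      ≡⟨ cong₂ _+_ select select ⟩
    X k + X k ∎
    where
    select : Σ< N (λ i → ind (i ≡ᵇ m + k) * (suc i ▷ v i k) N) ≡ X k
    -- If m+k ≥ N, a first part m+k+1 exceeds the total N.
    select = Σ<-select N (m + k) (λ i → (suc i ▷ v i k) N) (λ N≤ → ▷-below (suc (m + k)) (v (m + k) k) (s≤s N≤))

-- `Nbar-F` speaks of positive sizes, so n = 0 and n = 1 are settled by evaluation.
Nbar-mono : ∀ m n → n ≢ m + 2 → ¬ (m ≡ 0 × n ≡ 4) → Nbar (pos m) (pos n ℤ.- pos 1) ≤ Nbar (pos m) (pos n)
Nbar-mono m zero _ _ = z≤n
Nbar-mono zero (suc zero) _ _ = s≤s z≤n
Nbar-mono (suc m) (suc zero) _ _ = z≤n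
Nbar-mono m (suc (suc n)) n≢ ¬e = subst₂ _≤_ (sym (Nbar-F m n)) (sym (Nbar-F m (suc n))) (+-mono-≤ step step)
  where
  step : F m 0 (suc n) ≤ F m 0 (suc (suc n))
  step = F-mono m (suc n) n≢ ¬e

-- Appending a part
Unique-concatMap : (f : A → List B) → (∀ x → Unique (f x)) →
  (∀ {x y z} → z ∈ f x → z ∈ f y → x ≡ y) → ∀ {xs} → Unique xs → Unique (concatMap f xs)
Unique-concatMap f f! disjoint [] = []
Unique-concatMap f f! disjoint {x ∷ xs} (x∉xs ∷ xs!) =
  Unique.++⁺ (f! x) (Unique-concatMap f f! disjoint xs!) λ (z∈fx , z∈rest) →
    let (y , y∈xs , z∈fy) = find (∈-concatMap⁻ f z∈rest) in
    All.lookup x∉xs y∈xs (disjoint z∈fx z∈fy)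

Unique-listsOfLength : ∀ k {xs : List A} → Unique xs → Unique (listsOfLength k xs)
Unique-listsOfLength zero xs! = [] ∷ []
Unique-listsOfLength (suc k) {xs} xs! = Unique-concatMap _
  (λ x → Unique.map⁺ (λ e → proj₂ (∷-injective e)) (Unique-listsOfLength k xs!))
  same-head xs!
  where
  same-head : ∀ {x y z} → z ∈ map (x ∷_) (listsOfLength k xs) → z ∈ map (y ∷_) (listsOfLength k xs) → x ≡ y
  same-head {x} {y} p q with ∈-map⁻ (x ∷_) p | ∈-map⁻ (y ∷_) q
  ... | _ , _ , refl | _ , _ , refl = refl

length-∈-listsOfLength : ∀ k {xs : List A} {l} → l ∈ listsOfLength k xs → length l ≡ k
length-∈-listsOfLength zero (here refl) = refl
length-∈-listsOfLength (suc k) {xs} l∈ with find (∈-concatMap⁻ (λ x → map (x ∷_) (listsOfLength k xs)) {xs = xs} l∈)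
... | x , _ , l∈′ with ∈-map⁻ (x ∷_) l∈′
... | _ , l″∈ , refl = cong suc (length-∈-listsOfLength k l″∈)

∈-listsOfLength : ∀ {xs l : List A} → All (_∈ xs) l → l ∈ listsOfLength (length l) xs
∈-listsOfLength [] = here refl
∈-listsOfLength {xs = xs} {x ∷ l} (x∈xs ∷ l⊆xs) =
  ∈-concatMap⁺ (λ x → map (x ∷_) (listsOfLength (length l) xs)) (lose x∈xs (∈-map⁺ (x ∷_) (∈-listsOfLength l⊆xs)))

Unique-parts : ∀ n → Unique (parts n)
Unique-parts n = Unique-concatMap _ (λ i → ((λ ()) ∷ []) ∷ [] ∷ []) same-value (Unique.upTo⁺ n)
  where
  same-value : ∀ {i j x} → x ∈ (suc i , false) ∷ (suc i , true) ∷ [] → x ∈ (suc j , false) ∷ (suc j , true) ∷ [] → i ≡ j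
  same-value (here refl) (here refl) = refl
  same-value (there (here refl)) (there (here refl)) = refl
  same-value (here refl) (there (here ()))
  same-value (there (here refl)) (here ())

∈-parts : ∀ {n p} o → 1 ≤ p → p ≤ n → (p , o) ∈ parts n
∈-parts {n} {suc i} o _ i<n = ∈-concatMap⁺ _ (lose (∈-upTo⁺ i<n) (either o))
  where
  either : ∀ o → (suc i , o) ∈ (suc i , false) ∷ (suc i , true) ∷ []
  either false = here refl
  either true = there (here refl)

-- Counts are lengths of lists, so an injection compares them only if nothing is listed twice.
-- Blocks of different lengths are disjoint.
Unique-overpartitions : ∀ n → Unique (overpartitions n)
Unique-overpartitions n = Unique.filter⁺ (λ l → isOverpartitionOf n l Bool.≟ true) (Unique-concatMap (λ k → listsOfLength k (parts n))
  (λ k → Unique-listsOfLength k (Unique-parts n))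
  (λ {k} {k′} l∈ l∈′ → trans (sym (length-∈-listsOfLength k l∈)) (length-∈-listsOfLength k′ l∈′))
  (Unique.upTo⁺ (suc n)))

-- Completeness of the enumeration

∧-true⁻ : ∀ {a b} → a ∧ b ≡ true → a ≡ true × b ≡ true
∧-true⁻ {true} {true} _ = refl , refl

≡ᵇ-true⁻ : ∀ {m n} → (m ≡ᵇ n) ≡ true → m ≡ n
≡ᵇ-true⁻ {m} {n} e = ≡ᵇ⇒≡ m n (subst Bool.T (sym e) _)

Positive : Overpartition → Set
Positive = All (λ x → 1 ≤ proj₁ x)

≤ᵇ-true⁻ : ∀ {m n} → (m ℕ.≤ᵇ n) ≡ true → m ≤ n
≤ᵇ-true⁻ {m} {n} e = ≤ᵇ⇒≤ m n (subst Bool.T (sym e) _)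

validFrom-positive : ∀ prev l → validFrom prev l ≡ true → Positive l
validFrom-positive prev [] _ = []
validFrom-positive prev ((p , o) ∷ l) e =
  let (1≤p , e₁) = ∧-true⁻ e ; (_ , e₂) = ∧-true⁻ {p ℕ.≤ᵇ prev} e₁ ; (_ , e₃) = ∧-true⁻ {not o ∨ _} e₂ in
  ≤ᵇ-true⁻ 1≤p ∷ validFrom-positive p l e₃

isOverpartitionOf-size : ∀ {n} l → isOverpartitionOf n l ≡ true → size l ≡ n
isOverpartitionOf-size {n} [] e = sym (≡ᵇ-true⁻ {n} e)
isOverpartitionOf-size (x ∷ l) e = ≡ᵇ-true⁻ (proj₁ (∧-true⁻ e))

isOverpartitionOf-positive : ∀ {n} l → isOverpartitionOf n l ≡ true → Positive l
isOverpartitionOf-positive [] e = []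
isOverpartitionOf-positive {n} ((p , o) ∷ l) e =
  let (1≤p , e′) = ∧-true⁻ (proj₂ (∧-true⁻ {size ((p , o) ∷ l) ≡ᵇ n} e)) in
  ≤ᵇ-true⁻ 1≤p ∷ validFrom-positive p l e′

length≤size : ∀ {l} → Positive l → length l ≤ size l
length≤size [] = z≤n
length≤size (1≤p ∷ l⁺) = +-mono-≤ 1≤p (length≤size l⁺)

⊆-parts : ∀ {l n} → Positive l → size l ≤ n → All (_∈ parts n) l
⊆-parts [] _ = []
⊆-parts {(p , o) ∷ l} (1≤p ∷ l⁺) |l|≤n =
  ∈-parts o 1≤p (m+n≤o⇒m≤o p |l|≤n) ∷ ⊆-parts l⁺ (m+n≤o⇒n≤o p |l|≤n)

-- Positivity of the parts bounds both their number and each part by n, which puts `l` among the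
-- `candidates`.
∈-overpartitions : ∀ {n} l → isOverpartitionOf n l ≡ true → l ∈ overpartitions n
∈-overpartitions {n} l e with refl ← isOverpartitionOf-size l e =
  ∈-filter⁺ (λ l → isOverpartitionOf n l Bool.≟ true)
    (∈-concatMap⁺ (λ k → listsOfLength k (parts n))
      (lose (∈-upTo⁺ (s≤s (length≤size l⁺))) (∈-listsOfLength (⊆-parts l⁺ ≤-refl))))
    e
  where l⁺ = isOverpartitionOf-positive l e

-- The head of `xs` is cut out of `ys`; uniqueness guarantees that the other elements of `xs`
-- survive the cut.
length-mono-⊆ : {xs ys : List A} → Unique xs → (∀ {x} → x ∈ xs → x ∈ ys) → length xs ≤ length ys
length-mono-⊆ [] _ = z≤n
length-mono-⊆ {xs = x ∷ xs} (x∉xs ∷ xs!) ⊆ys with ∈-∃++ (⊆ys (here refl))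
... | as , bs , refl = begin
  suc (length xs)           ≤⟨ s≤s (length-mono-⊆ xs! ⊆-rest) ⟩
  suc (length (as ++ bs))   ≡⟨ cong suc (length-++ as) ⟩
  suc (length as + length bs) ≡⟨ +-suc (length as) (length bs) ⟨
  length as + suc (length bs) ≡⟨ length-++ as ⟨
  length (as ++ x ∷ bs)     ∎
  where
  open ≤-Reasoning
  ⊆-rest : ∀ {z} → z ∈ xs → z ∈ as ++ bs
  ⊆-rest z∈xs with ∈-++⁻ as (⊆ys (there z∈xs))
  ... | inj₁ z∈as = ∈-++⁺ˡ z∈as
  ... | inj₂ (here refl) = contradiction refl (All.lookup x∉xs z∈xs)
  ... | inj₂ (there z∈bs) = ∈-++⁺ʳ as z∈bs

-- Appending a part 1 and the M₂-rank

addOne : Overpartition → Overpartition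
addOne l = l ∷ʳ (1 , false)

1≤⇒≤ᵇ : ∀ {p} → 1 ≤ p → (1 ℕ.≤ᵇ p) ≡ true
1≤⇒≤ᵇ (s≤s _) = refl

∧-true⁺ : ∀ {a b} → a ≡ true → b ≡ true → a ∧ b ≡ true
∧-true⁺ refl refl = refl

validFrom-addOne : ∀ {prev} l → 1 ≤ prev → validFrom prev l ≡ true → validFrom prev (addOne l) ≡ true
validFrom-addOne {prev} [] 1≤prev _ = ∧-true⁺ (1≤⇒≤ᵇ 1≤prev) refl
validFrom-addOne {prev} ((p , o) ∷ l) _ e =
  let (1≤p , e₁) = ∧-true⁻ {1 ℕ.≤ᵇ p} e ; (p≤ , e₂) = ∧-true⁻ {p ℕ.≤ᵇ prev} e₁ ; (p< , e₃) = ∧-true⁻ {not o ∨ (p <ᵇ prev)} e₂ in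
  ∧-true⁺ {1 ℕ.≤ᵇ p} 1≤p (∧-true⁺ p≤ (∧-true⁺ p< (validFrom-addOne l (≤ᵇ-true⁻ {1} 1≤p) e₃)))

size-addOne : ∀ l → size (addOne l) ≡ suc (size l)
size-addOne l = begin
  sum (map proj₁ (addOne l))         ≡⟨ cong sum (map-++ proj₁ l _) ⟩
  sum (map proj₁ l ++ 1 ∷ [])        ≡⟨ sum-++ (map proj₁ l) _ ⟩
  size l + 1                         ≡⟨ +-comm (size l) 1 ⟩
  suc (size l)                       ∎
  where open ≡-Reasoning

isOverpartitionOf-addOne : ∀ {n} l → isOverpartitionOf n l ≡ true → isOverpartitionOf (suc n) (addOne l) ≡ true
isOverpartitionOf-addOne {zero} [] _ = refl
isOverpartitionOf-addOne {n} ((p , o) ∷ l) e =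
  let (size≡ , e₁) = ∧-true⁻ {size ((p , o) ∷ l) ≡ᵇ n} e ; (1≤p , e₂) = ∧-true⁻ e₁ in
  ∧-true⁺ (trans (cong (_≡ᵇ suc n) (size-addOne ((p , o) ∷ l))) size≡)
    (∧-true⁺ 1≤p (validFrom-addOne l (≤ᵇ-true⁻ 1≤p) e₂))

-- `addOne` is injective and raises the size by one, so it embeds the overpartitions counted at n
-- into those counted at n+1.
countWith-mono : ∀ r m n → (∀ l → r (addOne l) ≡ r l) → countWith r m n ≤ countWith r m (suc n)
countWith-mono r m n r-addOne = subst (_≤ countWith r m (suc n)) (length-map addOne counted)
  (length-mono-⊆ (Unique.map⁺ (λ {l} {l′} → ∷ʳ-injectiveˡ l l′) (Unique.filter⁺ (λ l → r l ℤ.≟ m) (Unique-overpartitions n))) into)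
  where
  counted = filter (λ l → r l ℤ.≟ m) (overpartitions n)
  into : ∀ {x} → x ∈ map addOne counted → x ∈ filter (λ l → r l ℤ.≟ m) (overpartitions (suc n))
  into x∈ with ∈-map⁻ addOne x∈
  ... | l , l∈ , refl with ∈-filter⁻ (λ l → r l ℤ.≟ m) {xs = overpartitions n} l∈
  ... | l∈n , rl≡m = ∈-filter⁺ (λ l → r l ℤ.≟ m)
    (∈-overpartitions (addOne l) (isOverpartitionOf-addOne l (proj₂ (∈-filter⁻ (λ l → isOverpartitionOf n l Bool.≟ true) {xs = candidates n} l∈n))))
    (trans (r-addOne l) rl≡m)

-- The first part, hence its contribution and χ, is unchanged, while the number of parts and the
-- number of non-overlined odd parts both rise by one and cancel. For the empty overpartition all
-- four terms rise from 0 to 1 and cancel in pairs.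
m2Rank-addOne : ∀ l → m2Rank (addOne l) ≡ m2Rank l
m2Rank-addOne [] = refl
m2Rank-addOne ((p , o) ∷ l) = begin
  a ℤ.- pos (length (addOne λ′)) ℤ.+ pos (numNonOverlinedOdd (addOne λ′)) ℤ.- c
    ≡⟨ cong₂ (λ x z → a ℤ.- pos x ℤ.+ pos z ℤ.- c) |addOne| odd-addOne ⟩
  a ℤ.- (pos 1 ℤ.+ pos (length λ′)) ℤ.+ (pos 1 ℤ.+ pos (numNonOverlinedOdd λ′)) ℤ.- c
    ≡⟨ cancel a c (pos (length λ′)) (pos (numNonOverlinedOdd λ′)) ⟩
  m2Rank λ′ ∎
  where
  open ≡-Reasoning
  λ′ = (p , o) ∷ l
  a = pos (suc p ℕ./ 2)
  c = pos (chi λ′)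
  cancel : ∀ a c x z → a ℤ.- (pos 1 ℤ.+ x) ℤ.+ (pos 1 ℤ.+ z) ℤ.- c ≡ a ℤ.- x ℤ.+ z ℤ.- c
  cancel = ℤ-Solver.solve-∀
  |addOne| : length (addOne λ′) ≡ suc (length λ′)
  |addOne| = trans (length-++ λ′) (+-comm (length λ′) 1)
  odd? : (x : ℕ × Bool) → _
  odd? x = (isOdd (proj₁ x) ∧ not (proj₂ x)) Bool.≟ true
  odd-addOne : numNonOverlinedOdd (addOne λ′) ≡ suc (numNonOverlinedOdd λ′)
  odd-addOne = begin
    length (filter odd? (addOne λ′))             ≡⟨ cong length (filter-++ odd? λ′ _) ⟩
    length (filter odd? λ′ ++ (1 , false) ∷ [])  ≡⟨ length-++ (filter odd? λ′) ⟩
    numNonOverlinedOdd λ′ + 1                    ≡⟨ +-comm (numNonOverlinedOdd λ′) 1 ⟩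
    suc (numNonOverlinedOdd λ′)                  ∎

N2bar-mono : ∀ m n → N2bar (pos m) (pos n ℤ.- pos 1) ≤ N2bar (pos m) (pos n)
N2bar-mono m zero = z≤n
N2bar-mono m (suc n) = countWith-mono m2Rank (pos m) n m2Rank-addOne

open import Data.Integer using (+_; _-_)

theorem1p4 : ((m n : ℕ) → n ≢ m + 2 → ¬ (m ≡ 0 × n ≡ 4) →
    Nbar (+ m) (+ n - + 1) ≤ Nbar (+ m) (+ n))
    × ((m n : ℕ) → N2bar (+ m) (+ n - + 1) ≤ N2bar (+ m) (+ n))
theorem1p4 = Nbar-mono , N2bar-mono
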